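{- Let $P$ be a finite interval order. Every redundant cycle inequality of the key graph $G_P$ (equivalently, of the length polyhedron $Q_P$) can be expressed as a non-negative integral linear combination of other cycle inequalities, i.e., of cycle inequalities not equivalent to it.
   Context: A finite partial order $P=([n],\prec)$ is an interval order if there are compact real intervals $I_x=[\ell_x,r_x]$ with $x\prec y$ iff $r_x<\ell_y$; write $x\parallel y$ if $x\ne y$ are incomparable. The canonical representation $[\ell_x,r_x]_{x\in[n]}$ of $P$ is the (unique) representation using the minimum number $m$ of distinct endpoints, placed at $0,\dots,m-1$. For $y\not\prec x$, the slack of $(x,y)$ there is $\ell_y-r_x-1$ if $x\prec y$, $r_y-\ell_x$ if $x\parallel y$, $r_x-\ell_x$ if $x=y$; slack-$0$ pairs are slack zero pairs, called cover pairs if $x\prec y$ and sharp pairs if $x\parallel y$. The key graph $G_P$ has vertex set $\{\rho_1,\dots,\rho_n\}$ and colored, weighted arcs (weights being linear inequalities in $\ell_1,\dots,\ell_n,\rho_1,\dots,\rho_n$): a blue arc $\rho_x\to\rho_y$ of weight $\langle\ell_x+\rho_x+1\le\ell_y\rangle$ for each slack zero cover pair; a red arc $\rho_x\to\rho_y$ of weight $\langle\ell_x\le\ell_y+\rho_y\rangle$ for each slack zero sharp pair; a red loop at $\rho_x$ of weight $\langle-\rho_x\le0\rangle$ for each slack zero pair $(x,x)$. For a directed cycle $C$ (loops included), the sum of its arc weights (added termwise, with cancellation) is its cycle inequality $\langle\gamma+\sum_{i\in A}\rho_i\le\sum_{j\in B}\rho_j\rangle$, where $\gamma$ is the number of blue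 arcs of $C$, and for consecutive arcs $\rho_x\to\rho_y\to\rho_z$ of $C$, $y\in A$ if both are blue and $y\in B$ if both are red. Inequalities are equivalent if they coincide after simplification. The length polyhedron $Q_P$ is the convex hull of the length vectors $(r_x-\ell_x)_x$ of integer-endpoint representations of $P$; it is known to be the set of $\rho\in\mathbb R^n$ satisfying all cycle inequalities. A cycle inequality $W$ is redundant if $W=\sum_{i=1}^t\alpha_iW_i$ for some cycle inequalities $W_i$ not equivalent to $W$ and rational $\alpha_i\ge0$. -}

module Defs where

open import Data.Nat as ℕ using (ℕ; zero; suc)
open import Data.Fin using (Fin; zero; suc; inject₁; fromℕ; _≟_)
open import Data.Integer as ℤ using (ℤ; +_)
open import Data.Rational as ℚ using (ℚ; 0ℚ)
open import Data.Product using (Σ; ∃; _×_; _,_)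
open import Data.Sum using (_⊎_)
open import Relation.Nullary using (¬_; yes; no)
open import Relation.Binary.PropositionalEquality using (_≡_; _≢_)
open import Function.Definitions using (Injective)

Rel : ℕ → Set₁
Rel n = Fin n → Fin n → Set

IsRepresentation : ∀ {n} → Rel n → (Fin n → ℕ) → (Fin n → ℕ) → Set
IsRepresentation {n} P ℓ r =
  (∀ x → ℓ x ℕ.≤ r x) ×
  (∀ (x y : Fin n) → (P x y → r x ℕ.< ℓ y) × (r x ℕ.< ℓ y → P x y))

UsesExactly : ∀ {n} → ℕ → (Fin n → ℕ) → (Fin n → ℕ) → Set
UsesExactly {n} m ℓ r =
  (∀ x → (ℓ x ℕ.< m) × (r x ℕ.< m)) ×
  (∀ k → k ℕ.< m → ∃ λ (x : Fin n) → (ℓ x ≡ k) ⊎ (r x ≡ k))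

-- Every set of values containing all endpoints of (ℓ , r) has at least
-- m elements, i.e. (ℓ , r) has at least m distinct endpoints.
AtLeastEndpoints : ∀ {n} → ℕ → (Fin n → ℕ) → (Fin n → ℕ) → Set
AtLeastEndpoints {n} m ℓ r =
  ∀ (k : ℕ) (e : Fin k → ℕ) →
  (∀ x → (∃ λ i → e i ≡ ℓ x) × (∃ λ i → e i ≡ r x)) → m ℕ.≤ k

IsCanonical : ∀ {n} → Rel n → (Fin n → ℕ) → (Fin n → ℕ) → Set
IsCanonical {n} P ℓ r =
  IsRepresentation P ℓ r ×
  Σ ℕ λ m → UsesExactly m ℓ r ×
    (∀ (ℓ′ r′ : Fin n → ℕ) → IsRepresentation P ℓ′ r′ → AtLeastEndpoints m ℓ′ r′)

module KeyGraph {n : ℕ} (P : Rel n) (ℓ r : Fin n → ℕ) where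

  Incomparable : Fin n → Fin n → Set
  Incomparable x y = (x ≢ y) × ¬ P x y × ¬ P y x

  CoverZero : Fin n → Fin n → Set
  CoverZero x y = P x y × (ℓ y ≡ suc (r x))

  SharpZero : Fin n → Fin n → Set
  SharpZero x y = Incomparable x y × (r y ≡ ℓ x)

  LoopZero : Fin n → Set
  LoopZero x = r x ≡ ℓ x

  data Arc : Fin n → Fin n → Set where
    blue : ∀ {x y} → CoverZero x y → Arc x y
    red  : ∀ {x y} → SharpZero x y → Arc x y
    loop : ∀ {x} → LoopZero x → Arc x x

  -- Linear inequalities in ℓ_1..ℓ_n, ρ_1..ρ_n, normalised (after
  -- moving everything to the left and cancelling) to the form
  --    const + Σ lco i · ℓ_i + Σ rco i · ρ_i ≤ 0

  record Form (A : Set) : Set where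
    constructor form
    field
      const : A
      lco   : Fin n → A
      rco   : Fin n → A
  open Form public

  -- equivalence = coincidence after simplification
  _≈_ : ∀ {A} → Form A → Form A → Set
  F ≈ G = (const F ≡ const G) × (∀ i → lco F i ≡ lco G i) × (∀ i → rco F i ≡ rco G i)

  e : Fin n → Fin n → ℤ
  e x i with x ≟ i
  ... | yes _ = + 1
  ... | no  _ = + 0

  0F : Form ℤ
  0F = form (+ 0) (λ _ → + 0) (λ _ → + 0)

  _⊕_ : Form ℤ → Form ℤ → Form ℤ
  F ⊕ G = form (const F ℤ.+ const G) (λ i → lco F i ℤ.+ lco G i)
               (λ i → rco F i ℤ.+ rco G i)

  weight : ∀ {x y} → Arc x y → Form ℤ
  -- ⟨ ℓ_x + ρ_x + 1 ≤ ℓ_y ⟩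
  weight {x} {y} (blue _) =
    form (+ 1) (λ i → e x i ℤ.- e y i) (λ i → e x i)
  -- ⟨ ℓ_x ≤ ℓ_y + ρ_y ⟩
  weight {x} {y} (red _) =
    form (+ 0) (λ i → e x i ℤ.- e y i) (λ i → ℤ.- e y i)
  -- ⟨ -ρ_x ≤ 0 ⟩
  weight {x} (loop _) =
    form (+ 0) (λ _ → + 0) (λ i → ℤ.- e x i)

  -- Directed cycles of G_P: distinct vertices v_0, …, v_k with arcs
  -- v_0 → v_1 → ⋯ → v_k → v_0  (k = 0 gives a loop).

  record Cycle : Set where
    field
      k      : ℕ
      v      : Fin (suc k) → Fin n
      simple : Injective _≡_ _≡_ v
      arc    : (i : Fin k) → Arc (v (inject₁ i)) (v (suc i))
      close  : Arc (v (fromℕ k)) (v zero)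

  sumArcs : ∀ {k} → (Fin k → Form ℤ) → Form ℤ
  sumArcs {zero}  f = 0F
  sumArcs {suc k} f = f zero ⊕ sumArcs (λ i → f (suc i))

  cycleIneq : Cycle → Form ℤ
  cycleIneq C = sumArcs (λ i → weight (arc i)) ⊕ weight close
    where open Cycle C

  Equivalent : Cycle → Cycle → Set
  Equivalent C D = cycleIneq C ≈ cycleIneq D

  toℚ : ℤ → ℚ
  toℚ z = z ℚ./ 1

  formℚ : Form ℤ → Form ℚ
  formℚ F = form (toℚ (const F)) (λ i → toℚ (lco F i)) (λ i → toℚ (rco F i))

  scaleℚ : ℚ → Form ℚ → Form ℚ
  scaleℚ a F = form (a ℚ.* const F) (λ i → a ℚ.* lco F i) (λ i → a ℚ.* rco F i)

  sumℚ : ∀ {t} → (Fin t → Form ℚ) → Form ℚ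
  sumℚ {zero}  f = form 0ℚ (λ _ → 0ℚ) (λ _ → 0ℚ)
  sumℚ {suc t} f = form (const (f zero) ℚ.+ const rest)
                        (λ i → lco (f zero) i ℚ.+ lco rest i)
                        (λ i → rco (f zero) i ℚ.+ rco rest i)
    where rest = sumℚ (λ i → f (suc i))

  scaleℕ : ℕ → Form ℤ → Form ℤ
  scaleℕ a F = form (+ a ℤ.* const F) (λ i → + a ℤ.* lco F i) (λ i → + a ℤ.* rco F i)

  sumℤ : ∀ {t} → (Fin t → Form ℤ) → Form ℤ
  sumℤ {zero}  f = 0F
  sumℤ {suc t} f = f zero ⊕ sumℤ (λ i → f (suc i))

  Redundant : Cycle → Set
  Redundant C =
    Σ ℕ λ t → Σ (Fin t → Cycle) λ D → Σ (Fin t → ℚ) λ α →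
      (∀ i → 0ℚ ℚ.≤ α i) × (∀ i → ¬ Equivalent (D i) C) ×
      (formℚ (cycleIneq C) ≈ sumℚ (λ i → scaleℚ (α i) (formℚ (cycleIneq (D i)))))

  IntegrallyRedundant : Cycle → Set
  IntegrallyRedundant C =
    Σ ℕ λ t → Σ (Fin t → Cycle) λ D → Σ (Fin t → ℕ) λ β →
      (∀ i → ¬ Equivalent (D i) C) ×
      (cycleIneq C ≈ sumℤ (λ i → scaleℕ (β i) (cycleIneq (D i))))

{-# OPTIONS --safe #-}
module Submission where

-- Call suc (r x) the blue and ℓ x the red hub of an arc leaving x.  A cycle with two
-- arcs of one colour through one hub splits into two closed walks by exchanging their
-- heads, and so does a cycle that turns at both endpoints of some interval z, which can
-- be traversed once in each direction; closed walks decompose into simple cycles, which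
-- gives an integral combination.  Now let C admit neither operation and let D occur with
-- a positive coefficient in a rational combination equal to C.  The number of arcs of C
-- of a given colour through a given hub is a linear functional of its inequality, and
-- together with the coordinates of the inequality it yields functionals that are
-- nonnegative on all arcs and vanish on C, hence on D.  They force D to go from hub to
-- hub as C does, so D is equivalent to C, a contradiction.

open import Defs
open import Data.Nat as ℕ using (ℕ; zero; suc; z≤n)
import Data.Nat.Properties as ℕ
open import Data.Fin using (Fin; zero; suc; inject₁; fromℕ; toℕ; _≟_)
open import Data.Fin.Properties as Fin using (toℕ-inject₁; toℕ-fromℕ; any?)
open import Data.Fin.Relation.Unary.Top
  using (View; view; ‵fromℕ; ‵inj₁; ‵inject₁; view-fromℕ; view-inject₁)
open import Data.Fin.Induction using (<-weakInduction)
open import Data.Integer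
  using (ℤ; +_; _+_; _*_; -_; _-_; _≤_; _<_; ∣_∣; 0ℤ; 1ℤ; +≤+; +<+)
import Data.Integer.Properties as ℤ
open import Data.Rational as ℚ using (ℚ; 0ℚ)
import Data.Rational.Properties as ℚ
import Data.Rational.Unnormalised as ℚᵘ
import Data.Rational.Unnormalised.Properties as ℚᵘ
open import Data.Rational.Solver using () renaming (module +-*-Solver to ℚSolver)
open import Data.Integer.Tactic.RingSolver using (solve-∀)
open import Data.Nat.Tactic.RingSolver using () renaming (solve-∀ to ℕsolve-∀)
open import Data.Bool using (true; false; if_then_else_)
open import Data.Product using (Σ; ∃; ∃₂; _×_; _,_; proj₁; proj₂)
open import Data.Sum using (_⊎_; inj₁; inj₂)
open import Data.List using (List; []; _∷_; _++_; length; lookup)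
open import Data.List.Membership.Propositional.Properties using (∈-lookup)
open import Data.List.Relation.Unary.All as All using (All; []; _∷_)
open import Data.List.Relation.Unary.All.Properties using (++⁺)
open import Data.Empty using (⊥)
open import Data.Unit using (⊤; tt)
open import Function using (_∘_)
open import Relation.Nullary using (¬_; Dec; yes; no; does; contradiction)
open import Relation.Nullary.Decidable using (dec-true; dec-false; _⊎-dec_; _×-dec_; ¬?)
open import Relation.Binary.Definitions using (tri<; tri≈; tri>)
open import Relation.Binary.PropositionalEquality
  using (_≡_; _≢_; refl; sym; trans; cong; cong₂; subst; subst₂; module ≡-Reasoning)
import Algebra.Definitions.RawMonoid ℚ.+-0-rawMonoid as ℚsum
import Relation.Binary.Reasoning.Setoid as SetoidReasoning
open import Algebra.Properties.AbelianGroup ℤ.+-0-abelianGroup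
  using () renaming (∙-cancelˡ to +-cancelˡ; ∙-cancelʳ to +-cancelʳ)
open import Algebra.Properties.Semiring.Sum ℤ.+-*-semiring
  using (sum; sum-cong-≗; ∑-distrib-+; *-distribˡ-sum; sum-replicate-zero; sum-init-last)

-- An inequality does not record the vertices at which its cycle changes colour: there the `ρ` terms
-- cancel or never occur. What stays visible is the number of arcs of each colour through each hub
-- and the vertices passed without a change of colour. Hence C and D can be compared only through
-- these data, and agreement of hubs rather than of vertices is the invariant carried around the two
-- cycles. The functionals are required to be nonnegative on single arcs, not merely on whole
-- cycles, so that their vanishing on D says something about every arc of D. Where one of the two
-- operations applies, the resulting cycles have strictly fewer arcs than C and all coefficients are
-- 1, a cycle being listed as often as it occurs; where neither applies, C is not redundant at all.

-- Finite sums of integers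

sum-nonneg : ∀ {k} (f : Fin k → ℤ) → (∀ i → 0ℤ ≤ f i) → 0ℤ ≤ sum f
sum-nonneg {zero}  f f≥0 = ℤ.≤-refl
sum-nonneg {suc k} f f≥0 = ℤ.+-mono-≤ (f≥0 zero) (sum-nonneg (f ∘ suc) (f≥0 ∘ suc))

nonneg+nonneg≡0ˡ : ∀ {a b} → 0ℤ ≤ a → 0ℤ ≤ b → a + b ≡ 0ℤ → a ≡ 0ℤ
nonneg+nonneg≡0ˡ {a} {b} a≥0 b≥0 a+b≡0 = ℤ.≤-antisym a≤0 a≥0
  where
  a≤0 : a ≤ 0ℤ
  a≤0 = subst (_≤ 0ℤ) (ℤ.+-identityʳ a)
          (ℤ.≤-trans (ℤ.+-monoʳ-≤ a b≥0) (ℤ.≤-reflexive a+b≡0))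

sum≡0⇒all≡0 : ∀ {k} (f : Fin k → ℤ) → (∀ i → 0ℤ ≤ f i) → sum f ≡ 0ℤ → ∀ i → f i ≡ 0ℤ
sum≡0⇒all≡0 {suc k} f f≥0 eq zero =
  nonneg+nonneg≡0ˡ (f≥0 zero) (sum-nonneg (f ∘ suc) (f≥0 ∘ suc)) eq
sum≡0⇒all≡0 {suc k} f f≥0 eq (suc i) =
  sum≡0⇒all≡0 (f ∘ suc) (f≥0 ∘ suc)
    (nonneg+nonneg≡0ˡ (sum-nonneg (f ∘ suc) (f≥0 ∘ suc)) (f≥0 zero)
      (trans (ℤ.+-comm (sum (f ∘ suc)) (f zero)) eq))
    i

*-swap : ∀ a b c → a * (b * c) ≡ b * (a * c)
*-swap = solve-∀

sum-zero : ∀ {k} (f : Fin k → ℤ) → (∀ i → f i ≡ 0ℤ) → sum f ≡ 0ℤ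
sum-zero {k} f f≡0 = trans (sum-cong-≗ f≡0) (sum-replicate-zero k)

-- Iverson brackets

δ : ∀ {a} {A : Set a} → Dec A → ℤ
δ d = if does d then 1ℤ else 0ℤ

δ-true : ∀ {a} {A : Set a} (d : Dec A) → A → δ d ≡ 1ℤ
δ-true d p = cong (if_then 1ℤ else 0ℤ) (dec-true d p)

δ-false : ∀ {a} {A : Set a} (d : Dec A) → ¬ A → δ d ≡ 0ℤ
δ-false d ¬p = cong (if_then 1ℤ else 0ℤ) (dec-false d ¬p)

1≢0 : 1ℤ ≢ 0ℤ
1≢0 ()

δ≥0 : ∀ {a} {A : Set a} (d : Dec A) → 0ℤ ≤ δ d
δ≥0 d with does d
... | true  = +≤+ z≤n
... | false = ℤ.≤-refl

δ≡0⇒¬ : ∀ {a} {A : Set a} (d : Dec A) → δ d ≡ 0ℤ → ¬ A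
δ≡0⇒¬ d eq p = 1≢0 (trans (sym (δ-true d p)) eq)

δ-δ≥0 : ∀ {a b} {A : Set a} {A′ : Set b} (d : Dec A) (d′ : Dec A′) → (A′ → A) → 0ℤ ≤ δ d - δ d′
δ-δ≥0 d (yes a′) A′⇒A rewrite δ-true d (A′⇒A a′) = ℤ.≤-refl
δ-δ≥0 d (no _)   A′⇒A rewrite ℤ.+-identityʳ (δ d) = δ≥0 d

δ-δ≡0⇒ : ∀ {a b} {A : Set a} {A′ : Set b} (d : Dec A) (d′ : Dec A′) →
         δ d - δ d′ ≡ 0ℤ → A → A′
δ-δ≡0⇒ d (yes a′) eq p = a′
δ-δ≡0⇒ d (no _)   eq p = contradiction p (δ≡0⇒¬ d (trans (sym (ℤ.+-identityʳ (δ d))) eq))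

⇒δ-δ≡0 : ∀ {a b} {A : Set a} {A′ : Set b} (d : Dec A) (d′ : Dec A′) →
         (A′ → A) → (A → A′) → δ d - δ d′ ≡ 0ℤ
⇒δ-δ≡0 d (yes a′) A′⇒A A⇒A′ rewrite δ-true d (A′⇒A a′) = refl
⇒δ-δ≡0 d (no ¬a′) A′⇒A A⇒A′ rewrite δ-false d (¬a′ ∘ A⇒A′) = refl

-- Together with `δ-suc-≤`, the source of all counting by hubs: a step function changes across one
-- unit exactly at its jump.
δ-≤-suc : ∀ p q → δ (p ℕ.≤? suc q) - δ (p ℕ.≤? q) ≡ δ (p ℕ.≟ suc q)
δ-≤-suc p q with ℕ.<-cmp p (suc q)
... | tri< p<1+q p≢1+q _
  rewrite δ-true (p ℕ.≤? suc q) (ℕ.<⇒≤ p<1+q)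
        | δ-true (p ℕ.≤? q) (ℕ.≤-pred p<1+q)
        | δ-false (p ℕ.≟ suc q) p≢1+q = refl
... | tri≈ _ p≡1+q _
  rewrite δ-true (p ℕ.≤? suc q) (ℕ.≤-reflexive p≡1+q)
        | δ-false (p ℕ.≤? q) (λ p≤q → ℕ.1+n≰n (subst (ℕ._≤ q) p≡1+q p≤q))
        | δ-true (p ℕ.≟ suc q) p≡1+q = refl
... | tri> _ p≢1+q 1+q<p
  rewrite δ-false (p ℕ.≤? suc q) (ℕ.<⇒≱ 1+q<p)
        | δ-false (p ℕ.≤? q) (ℕ.<⇒≱ (ℕ.<-trans (ℕ.n<1+n q) 1+q<p))
        | δ-false (p ℕ.≟ suc q) p≢1+q = refl

δ-suc-≤ : ∀ p q → δ (q ℕ.≤? p) - δ (suc q ℕ.≤? p) ≡ δ (p ℕ.≟ q)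
δ-suc-≤ p q with ℕ.<-cmp p q
... | tri< p<q p≢q _
  rewrite δ-false (q ℕ.≤? p) (ℕ.<⇒≱ p<q)
        | δ-false (suc q ℕ.≤? p) (ℕ.<⇒≱ (ℕ.m<n⇒m<1+n p<q))
        | δ-false (p ℕ.≟ q) p≢q = refl
... | tri≈ _ refl _
  rewrite δ-true (p ℕ.≤? p) ℕ.≤-refl
        | δ-false (suc p ℕ.≤? p) ℕ.1+n≰n
        | δ-true (p ℕ.≟ p) refl = refl
... | tri> _ p≢q q<p
  rewrite δ-true (q ℕ.≤? p) (ℕ.<⇒≤ q<p)
        | δ-true (suc q ℕ.≤? p) q<p
        | δ-false (p ℕ.≟ q) p≢q = refl

sum-δ : ∀ {k} (h : Fin k → ℤ) x → sum (λ y → h y * δ (x ≟ y)) ≡ h x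
sum-δ h zero =
  trans (cong₂ _+_ (ℤ.*-identityʳ (h zero)) (sum-zero _ λ y → ℤ.*-zeroʳ (h (suc y))))
        (ℤ.+-identityʳ (h zero))
sum-δ h (suc x) =
  trans (cong₂ _+_ (ℤ.*-zeroʳ (h zero)) (sum-δ (h ∘ suc) x)) (ℤ.+-identityˡ _)

sum-single : ∀ {k} (f : Fin k → ℤ) i → (∀ j → j ≢ i → f j ≡ 0ℤ) → sum f ≡ f i
sum-single f i off = trans (sum-cong-≗ only) (sum-δ f i)
  where
  only : ∀ j → f j ≡ f j * δ (i ≟ j)
  only j with i ≟ j
  ... | yes _   = sym (ℤ.*-identityʳ (f j))
  ... | no  i≢j = trans (off j (i≢j ∘ sym)) (sym (ℤ.*-zeroʳ (f j)))

-- Cyclic sequences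

-- Computing on the view makes the successor reduce to `zero` or `suc i` exactly where a cycle
-- offers `close` or `arc i`, so `arcAtᵛ` needs no transport.
nextᵛ : ∀ {k} {i : Fin (suc k)} → View i → Fin (suc k)
nextᵛ ‵fromℕ                = zero
nextᵛ (‵inj₁ {i = i} _) = suc i

next : ∀ {k} → Fin (suc k) → Fin (suc k)
next i = nextᵛ (view i)

next-fromℕ : ∀ k → next (fromℕ k) ≡ zero
next-fromℕ k rewrite view-fromℕ k = refl

next-inject₁ : ∀ {k} (i : Fin k) → next (inject₁ i) ≡ suc i
next-inject₁ i rewrite view-inject₁ i = refl

next-injective : ∀ {k} {i j : Fin (suc k)} → next i ≡ next j → i ≡ j
next-injective {i = i} {j} eq with view i | view j
... | ‵fromℕ | ‵fromℕ = refl
... | ‵inject₁ i′ | ‵inject₁ j′ = cong inject₁ (Fin.suc-injective eq)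

next-surjective : ∀ {k} (i : Fin (suc k)) → ∃ λ j → next j ≡ i
next-surjective {k} zero    = fromℕ k , next-fromℕ k
next-surjective     (suc i) = inject₁ i , next-inject₁ i

sum-next : ∀ {k} (g : Fin (suc k) → ℤ) → sum (λ i → g (next i)) ≡ sum g
sum-next {k} g = begin
  sum (λ i → g (next i))
    ≡⟨ sum-init-last (λ i → g (next i)) ⟩
  sum (λ i → g (next (inject₁ i))) + g (next (fromℕ k))
    ≡⟨ cong₂ _+_ (sum-cong-≗ (λ i → cong g (next-inject₁ i))) (cong g (next-fromℕ k)) ⟩
  sum (λ i → g (suc i)) + g zero
    ≡⟨ ℤ.+-comm _ (g zero) ⟩
  sum g ∎
  where open ≡-Reasoning

-- Positions on the cycle as natural numbers modulo `suc k`, so that a stretch running past the last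
-- vertex is an ordinary interval.
unroll : ∀ {k} → ℕ → Fin (suc k)
unroll zero    = zero
unroll (suc a) = next (unroll a)

unroll-toℕ : ∀ {k} (i : Fin (suc k)) → unroll (toℕ i) ≡ i
unroll-toℕ = <-weakInduction (λ i → unroll (toℕ i) ≡ i) refl λ i ih → begin
  next (unroll (toℕ i))            ≡⟨ cong (λ a → next (unroll a)) (sym (toℕ-inject₁ i)) ⟩
  next (unroll (toℕ (inject₁ i)))  ≡⟨ cong next ih ⟩
  next (inject₁ i)                 ≡⟨ next-inject₁ i ⟩
  suc i                            ∎
  where open ≡-Reasoning

unroll-+-period : ∀ {k} a → unroll {k} (a ℕ.+ suc k) ≡ unroll a
unroll-+-period {k} zero = begin
  next (unroll k)                  ≡⟨ cong (λ a → next (unroll a)) (sym (toℕ-fromℕ k)) ⟩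
  next (unroll (toℕ (fromℕ k)))    ≡⟨ cong next (unroll-toℕ (fromℕ k)) ⟩
  next (fromℕ k)                   ≡⟨ next-fromℕ k ⟩
  zero                             ∎
  where open ≡-Reasoning
unroll-+-period (suc a) = cong next (unroll-+-period a)

-- From `i₀` the property is carried to position `suc k`, which is `zero` again by periodicity, and
-- from there to every index.
next-induction : ∀ {k} {Q : Fin (suc k) → Set} i₀ → Q i₀ → (∀ i → Q i → Q (next i)) → ∀ i → Q i
next-induction {k} {Q} i₀ base step i = subst Q (unroll-toℕ i) (up-to (toℕ i))
  where
  around : ∀ b a → Q (unroll a) → Q (unroll (b ℕ.+ a))
  around zero    a q = q
  around (suc b) a q = step _ (around b a q)
  at-zero : Q zero
  at-zero = subst Q
    (trans (cong unroll (ℕ.m∸n+n≡m (ℕ.<⇒≤ (Fin.toℕ<n i₀)))) (unroll-+-period 0))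
    (around (suc k ℕ.∸ toℕ i₀) (toℕ i₀) (subst Q (sym (unroll-toℕ i₀)) base))
  up-to : ∀ a → Q (unroll a)
  up-to zero    = at-zero
  up-to (suc a) = step _ (up-to a)

window : (ℕ → ℤ) → ℕ → ℕ → ℤ
window f a zero    = 0ℤ
window f a (suc t) = f a + window f (suc a) t

window-+ : ∀ f a t u → window f a (t ℕ.+ u) ≡ window f a t + window f (t ℕ.+ a) u
window-+ f a zero    u = sym (ℤ.+-identityˡ _)
window-+ f a (suc t) u = begin
  f a + window f (suc a) (t ℕ.+ u)
    ≡⟨ cong (λ x → f a + x) (window-+ f (suc a) t u) ⟩
  f a + (window f (suc a) t + window f (t ℕ.+ suc a) u)
    ≡⟨ sym (ℤ.+-assoc (f a) _ _) ⟩
  f a + window f (suc a) t + window f (t ℕ.+ suc a) u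
    ≡⟨ cong (λ b → f a + window f (suc a) t + window f b u) (ℕ.+-suc t a) ⟩
  f a + window f (suc a) t + window f (suc t ℕ.+ a) u ∎
  where open ≡-Reasoning

-- The window of length `suc L` at `a` exceeds those of length `L` at `a` and at `suc a` by its last
-- and its first term, which periodicity identifies.
window-periodic : ∀ f L → (∀ a → f (a ℕ.+ L) ≡ f a) → ∀ a → window f a L ≡ window f 0 L
window-periodic f L per zero    = refl
window-periodic f L per (suc a) = trans (+-cancelˡ (f a) _ _ (begin
  f a + window f (suc a) L              ≡⟨⟩
  window f a (suc L)                    ≡⟨ cong (window f a) (ℕ.+-comm 1 L) ⟩
  window f a (L ℕ.+ 1)                  ≡⟨ window-+ f a L 1 ⟩
  window f a L + (f (L ℕ.+ a) + 0ℤ)     ≡⟨ cong (λ x → window f a L + x) (ℤ.+-identityʳ _) ⟩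
  window f a L + f (L ℕ.+ a)            ≡⟨ cong (λ b → window f a L + f b) (ℕ.+-comm L a) ⟩
  window f a L + f (a ℕ.+ L)            ≡⟨ cong (λ x → window f a L + x) (per a) ⟩
  window f a L + f a                    ≡⟨ ℤ.+-comm _ (f a) ⟩
  f a + window f a L                    ∎))
  (window-periodic f L per a)
  where open ≡-Reasoning

window-sum : ∀ f a L → window f a L ≡ sum {L} (λ i → f (a ℕ.+ toℕ i))
window-sum f a zero    = refl
window-sum f a (suc L) = cong₂ _+_ (cong f (sym (ℕ.+-identityʳ a)))
  (trans (window-sum f (suc a) L) (sum-cong-≗ {L} (λ i → cong f (sym (ℕ.+-suc a (toℕ i))))))

-- Clearing denominators

infix 7.5 _/1

_/1 : ℤ → ℚ
a /1 = a ℚ./ 1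

/1≃ : ∀ a → ℚ.toℚᵘ (a /1) ℚᵘ.≃ ℚᵘ.mkℚᵘ a 0
/1≃ a = ℚ.toℚᵘ-fromℚᵘ (ℚᵘ.mkℚᵘ a 0)

/1-injective : ∀ {a b} → a /1 ≡ b /1 → a ≡ b
/1-injective {a} {b} eq with ℚᵘ.≃-trans (ℚᵘ.≃-sym (/1≃ a)) (ℚᵘ.≃-trans (ℚᵘ.≃-reflexive (cong ℚ.toℚᵘ eq)) (/1≃ b))
... | ℚᵘ.*≡* a*1≡b*1 = ℤ.*-cancelʳ-≡ a b 1ℤ a*1≡b*1

/1-+ : ∀ a b → (a + b) /1 ≡ a /1 ℚ.+ b /1
/1-+ a b = ℚ.toℚᵘ-injective (begin
  ℚ.toℚᵘ ((a + b) /1)                        ≈⟨ /1≃ (a + b) ⟩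
  ℚᵘ.mkℚᵘ (a + b) 0                             ≈⟨ ℚᵘ.*≡* (ring a b) ⟩
  ℚᵘ.mkℚᵘ a 0 ℚᵘ.+ ℚᵘ.mkℚᵘ b 0                  ≈⟨ ℚᵘ.+-cong (ℚᵘ.≃-sym (/1≃ a)) (ℚᵘ.≃-sym (/1≃ b)) ⟩
  ℚ.toℚᵘ (a /1) ℚᵘ.+ ℚ.toℚᵘ (b /1)        ≈⟨ ℚᵘ.≃-sym (ℚ.toℚᵘ-homo-+ (a /1) (b /1)) ⟩
  ℚ.toℚᵘ (a /1 ℚ.+ b /1)                  ∎)
  where
  open SetoidReasoning ℚᵘ.≃-setoid
  ring : ∀ a b → (a + b) * 1ℤ ≡ (a * 1ℤ + b * 1ℤ) * 1ℤ
  ring = solve-∀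

/1-* : ∀ a b → (a * b) /1 ≡ a /1 ℚ.* b /1
/1-* a b = ℚ.toℚᵘ-injective (begin
  ℚ.toℚᵘ ((a * b) /1)                        ≈⟨ /1≃ (a * b) ⟩
  ℚᵘ.mkℚᵘ a 0 ℚᵘ.* ℚᵘ.mkℚᵘ b 0                  ≈⟨ ℚᵘ.*-cong (ℚᵘ.≃-sym (/1≃ a)) (ℚᵘ.≃-sym (/1≃ b)) ⟩
  ℚ.toℚᵘ (a /1) ℚᵘ.* ℚ.toℚᵘ (b /1)        ≈⟨ ℚᵘ.≃-sym (ℚ.toℚᵘ-homo-* (a /1) (b /1)) ⟩
  ℚ.toℚᵘ (a /1 ℚ.* b /1)                  ∎)
  where open SetoidReasoning ℚᵘ.≃-setoid

↧*-≡-↥ : ∀ p → (ℚ.↧ p) /1 ℚ.* p ≡ (ℚ.↥ p) /1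
↧*-≡-↥ p@record{} = ℚ.toℚᵘ-injective (begin
  ℚ.toℚᵘ ((ℚ.↧ p) /1 ℚ.* p)                  ≈⟨ ℚ.toℚᵘ-homo-* ((ℚ.↧ p) /1) p ⟩
  ℚ.toℚᵘ ((ℚ.↧ p) /1) ℚᵘ.* ℚ.toℚᵘ p          ≈⟨ ℚᵘ.*-congʳ {ℚ.toℚᵘ p} (/1≃ (ℚ.↧ p)) ⟩
  ℚᵘ.mkℚᵘ (ℚ.↧ p) 0 ℚᵘ.* ℚ.toℚᵘ p               ≈⟨ ℚᵘ.*≡* (ring (ℚ.↧ p) (ℚ.↥ p)) ⟩
  ℚᵘ.mkℚᵘ (ℚ.↥ p) 0                             ≈⟨ ℚᵘ.≃-sym (/1≃ (ℚ.↥ p)) ⟩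
  ℚ.toℚᵘ ((ℚ.↥ p) /1)                        ∎)
  where
  open SetoidReasoning ℚᵘ.≃-setoid
  ring : ∀ d n → d * n * 1ℤ ≡ n * (1ℤ * d)
  ring = solve-∀

∣↥∣ : ∀ p → 0ℚ ℚ.≤ p → + ∣ ℚ.↥ p ∣ ≡ ℚ.↥ p
∣↥∣ p@record{} p≥0 = ℤ.0≤i⇒+∣i∣≡i (ℤ.nonNegative⁻¹ (ℚ.↥ p) ⦃ ℚ.nonNegative p≥0 ⦄)

-- `N` and `m` are fixed before `d`, so one multiplier serves every coordinate of the inequality. As
-- `α` is nonnegative, the numerators survive as natural numbers.
clear-denominators : ∀ {t} (α : Fin t → ℚ) → (∀ i → 0ℚ ℚ.≤ α i) →
  Σ ℕ λ N → Σ (Fin t → ℕ) λ m → N ≢ 0 ×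
    ∀ (d : Fin t → ℤ) → + N /1 ℚ.* ℚsum.sum (λ i → α i ℚ.* d i /1) ≡ sum (λ i → + m i * d i) /1
clear-denominators {zero}  α α≥0 = 1 , (λ ()) , (λ ()) , λ d → refl
clear-denominators {suc t} α α≥0 with clear-denominators (λ i → α (suc i)) (λ i → α≥0 (suc i))
... | N , m , N≢0 , eq = den ℕ.* N , m′ , den*N≢0 , eq′
  where
  den = ℚ.↧ₙ (α zero)
  num = ∣ ℚ.↥ (α zero) ∣
  m′ : Fin (suc t) → ℕ
  m′ zero    = num ℕ.* N
  m′ (suc i) = den ℕ.* m i
  den*N≢0 : den ℕ.* N ≢ 0
  den*N≢0 p with ℕ.m*n≡0⇒m≡0∨n≡0 den p
  ... | inj₂ N≡0 = N≢0 N≡0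
  open ≡-Reasoning
  eq′ : ∀ (d : Fin (suc t) → ℤ) → + (den ℕ.* N) /1 ℚ.* ℚsum.sum (λ i → α i ℚ.* d i /1) ≡
              sum (λ i → + m′ i * d i) /1
  eq′ d = begin
    + (den ℕ.* N) /1 ℚ.* (α zero ℚ.* x ℚ.+ S)
      ≡⟨ cong (λ z → z /1 ℚ.* (α zero ℚ.* x ℚ.+ S)) (ℤ.pos-* den N) ⟩
    (+ den * + N) /1 ℚ.* (α zero ℚ.* x ℚ.+ S)
      ≡⟨ cong (λ z → z ℚ.* (α zero ℚ.* x ℚ.+ S)) (/1-* (+ den) (+ N)) ⟩
    D ℚ.* M ℚ.* (α zero ℚ.* x ℚ.+ S)
      ≡⟨ ringℚ D M (α zero) x S ⟩
    D ℚ.* α zero ℚ.* M ℚ.* x ℚ.+ D ℚ.* (M ℚ.* S)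
      ≡⟨ cong₂ (λ a b → a ℚ.* M ℚ.* x ℚ.+ D ℚ.* b) (trans (↧*-≡-↥ (α zero)) (cong _/1 (sym (∣↥∣ (α zero) (α≥0 zero))))) (eq (λ i → d (suc i))) ⟩
    (+ num) /1 ℚ.* M ℚ.* x ℚ.+ D ℚ.* rest /1
      ≡⟨ cong₂ ℚ._+_ (cong (ℚ._* x) (sym (/1-* (+ num) (+ N)))) (sym (/1-* (+ den) rest)) ⟩
    (+ num * + N) /1 ℚ.* x ℚ.+ (+ den * rest) /1
      ≡⟨ cong (ℚ._+ (+ den * rest) /1) (sym (/1-* (+ num * + N) (d zero))) ⟩
    (+ num * + N * d zero) /1 ℚ.+ (+ den * rest) /1
      ≡⟨ sym (/1-+ (+ num * + N * d zero) (+ den * rest)) ⟩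
    (+ num * + N * d zero + + den * rest) /1
      ≡⟨ cong _/1 (cong₂ _+_ (cong (_* d zero) (sym (ℤ.pos-* num N))) restEq) ⟩
    sum (λ i → + m′ i * d i) /1 ∎
    where
    x = d zero /1
    S = ℚsum.sum (λ i → α (suc i) ℚ.* d (suc i) /1)
    D = + den /1
    M = + N /1
    rest = sum (λ i → + m i * d (suc i))
    restEq : + den * rest ≡ sum (λ i → + (den ℕ.* m i) * d (suc i))
    restEq = trans (*-distribˡ-sum (+ den) (λ i → + m i * d (suc i))) (sum-cong-≗ {t} λ i →
      trans (sym (ℤ.*-assoc (+ den) (+ m i) (d (suc i)))) (cong (_* d (suc i)) (sym (ℤ.pos-* den (m i)))))
    ringℚ : ∀ D M a x S → D ℚ.* M ℚ.* (a ℚ.* x ℚ.+ S) ≡ D ℚ.* a ℚ.* M ℚ.* x ℚ.+ D ℚ.* (M ℚ.* S)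
    ringℚ = solve 5 (λ D M a x S → D :* M :* (a :* x :+ S) := D :* a :* M :* x :+ D :* (M :* S)) refl
      where open ℚSolver

module Cycles {n : ℕ} (P : Rel n) (ℓ r : Fin n → ℕ) (rep : IsRepresentation P ℓ r) where

  open KeyGraph P ℓ r

  -- Colours, hubs and the weights of arcs

  data Colour : Set where
    B R : Colour

  _≟ᶜ_ : (c d : Colour) → Dec (c ≡ d)
  B ≟ᶜ B = yes refl
  B ≟ᶜ R = no λ ()
  R ≟ᶜ B = no λ ()
  R ≟ᶜ R = yes refl

  -- An arc of colour c leads x → y precisely when the hub it leaves x through is
  -- the hub it enters y through, so two arcs sharing a hub can exchange their heads.
  outhub inhub : Colour → Fin n → ℕ
  outhub B x = suc (r x)
  outhub R x = ℓ x
  inhub  B y = ℓ y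
  inhub  R y = r y

  Link : Colour → Fin n → Fin n → Set
  Link c x y = outhub c x ≡ inhub c y

  data Coord : Set where
    κ   : Coord
    λᶜ ρᶜ : Fin n → Coord

  _!_ : Form ℤ → Coord → ℤ
  F ! κ    = const F
  F ! λᶜ u = lco F u
  F ! ρᶜ u = rco F u

  weightᶜ : Colour → Fin n → Fin n → Coord → ℤ
  weightᶜ B x y κ      = 1ℤ
  weightᶜ R x y κ      = 0ℤ
  weightᶜ c x y (λᶜ u) = e x u - e y u
  weightᶜ B x y (ρᶜ u) = e x u
  weightᶜ R x y (ρᶜ u) = - e y u

  e≡δ : ∀ x u → e x u ≡ δ (x ≟ u)
  e≡δ x u with x ≟ u
  ... | yes _ = refl
  ... | no  _ = refl

  -- Linear functionals on inequalities

  record Functional : Set where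
    field
      ap     : (Coord → ℤ) → ℤ
      ap-cong : ∀ {v w} → (∀ x → v x ≡ w x) → ap v ≡ ap w
      ap-+    : ∀ v w → ap (λ x → v x + w x) ≡ ap v + ap w
      ap-*    : ∀ a w → ap (λ x → a * w x) ≡ a * ap w

    ap-0 : ap (λ _ → 0ℤ) ≡ 0ℤ
    ap-0 = ap-* 0ℤ (λ _ → 0ℤ)

    ap-sum : ∀ {k} (w : Fin k → Coord → ℤ) → ap (λ x → sum (λ i → w i x)) ≡ sum (λ i → ap (w i))
    ap-sum {zero}  w = ap-0
    ap-sum {suc k} w = trans (ap-+ (w zero) _) (cong (λ t → ap (w zero) + t) (ap-sum (w ∘ suc)))

  open Functional

  coord : Coord → Functional
  coord x = record
    { ap = λ w → w x ; ap-cong = λ eq → eq x ; ap-+ = λ _ _ → refl ; ap-* = λ _ _ → refl }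

  infixl 6 _⊞_
  infixl 7 _⊡_

  _⊞_ : Functional → Functional → Functional
  φ ⊞ ψ = record
    { ap = λ w → ap φ w + ap ψ w
    ; ap-cong = λ eq → cong₂ _+_ (ap-cong φ eq) (ap-cong ψ eq)
    ; ap-+ = λ v w → trans (cong₂ _+_ (ap-+ φ v w) (ap-+ ψ v w))
                       (swap (ap φ v) (ap φ w) (ap ψ v) (ap ψ w))
    ; ap-* = λ a w → trans (cong₂ _+_ (ap-* φ a w) (ap-* ψ a w)) (sym (ℤ.*-distribˡ-+ a _ _))
    }
    where
    swap : ∀ a b c d → a + b + (c + d) ≡ a + c + (b + d)
    swap = solve-∀

  _⊡_ : ℤ → Functional → Functional
  a ⊡ φ = record
    { ap = λ w → a * ap φ w
    ; ap-cong = λ eq → cong (a *_) (ap-cong φ eq)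
    ; ap-+ = λ v w → trans (cong (a *_) (ap-+ φ v w)) (ℤ.*-distribˡ-+ a _ _)
    ; ap-* = λ b w → trans (cong (a *_) (ap-* φ b w)) (*-swap a b _)
    }

  pair : (Fin n → Coord) → (Fin n → ℤ) → Functional
  pair c a = record
    { ap = λ w → sum (λ u → a u * w (c u))
    ; ap-cong = λ eq → sum-cong-≗ (λ u → cong (a u *_) (eq (c u)))
    ; ap-+ = λ v w → trans (sum-cong-≗ (λ u → ℤ.*-distribˡ-+ (a u) (v (c u)) (w (c u))))
                       (∑-distrib-+ (λ u → a u * v (c u)) (λ u → a u * w (c u)))
    ; ap-* = λ b w → trans (sum-cong-≗ (λ u → *-swap (a u) b (w (c u))))
                       (sym (*-distribˡ-sum b (λ u → a u * w (c u))))
    }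

  pair-e : ∀ (a : Fin n → ℤ) x → sum (λ u → a u * e x u) ≡ a x
  pair-e a x = trans (sum-cong-≗ (λ u → cong (a u *_) (e≡δ x u))) (sum-δ a x)

  pair--e : ∀ (a : Fin n → ℤ) x → sum (λ u → a u * (- e x u)) ≡ - a x
  pair--e a x = begin
    sum (λ u → a u * (- e x u))     ≡⟨ sum-cong-≗ (λ u → neg (a u) (e x u)) ⟩
    sum (λ u → (- a u) * e x u)     ≡⟨ pair-e (λ u → - a u) x ⟩
    - a x                           ∎
    where
    open ≡-Reasoning
    neg : ∀ a b → a * (- b) ≡ (- a) * b
    neg = solve-∀

  pair-λ : ∀ a c x y → ap (pair λᶜ a) (weightᶜ c x y) ≡ a x - a y
  pair-λ a c x y = begin
    ap (pair λᶜ a) (weightᶜ c x y)                       ≡⟨ sum-cong-≗ (λ u → cong (a u *_) (λco c u)) ⟩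
    sum (λ u → a u * (e x u - e y u))                    ≡⟨ sum-cong-≗ (λ u → ℤ.*-distribˡ-+ (a u) (e x u) (- e y u)) ⟩
    sum (λ u → a u * e x u + a u * (- e y u))            ≡⟨ ∑-distrib-+ (λ u → a u * e x u) (λ u → a u * (- e y u)) ⟩
    sum (λ u → a u * e x u) + sum (λ u → a u * (- e y u)) ≡⟨ cong₂ _+_ (pair-e a x) (pair--e a y) ⟩
    a x - a y                                            ∎
    where
    open ≡-Reasoning
    λco : ∀ c u → weightᶜ c x y (λᶜ u) ≡ e x u - e y u
    λco B u = refl
    λco R u = refl

  eval : (Fin n → ℤ) → (Fin n → ℤ) → Functional
  eval a b = pair λᶜ a ⊞ pair ρᶜ b

  eval-B : ∀ a b x y → ap (eval a b) (weightᶜ B x y) ≡ a x - a y + b x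
  eval-B a b x y = cong₂ _+_ (pair-λ a B x y) (pair-e b x)

  eval-R : ∀ a b x y → ap (eval a b) (weightᶜ R x y) ≡ a x - a y - b y
  eval-R a b x y = cong₂ _+_ (pair-λ a R x y) (pair--e b y)

  -- Functionals counting arcs through a hub

  -- A step function is applied to all endpoints: `hubλ` is its value at the left endpoint, `hubρ`
  -- its change up to the right one. For `B`, a blue arc sees the step from `r x` to `suc (r x)`,
  -- while a red arc compares two equal endpoints. For `R`, right endpoints are read at `suc (r u)`:
  -- now blue arcs compare equal positions and a red arc sees the step from `ℓ x` to `suc (ℓ x)`.
  hubλ hubρ : Colour → ℕ → Fin n → ℤ
  hubλ B p u = - δ (p ℕ.≤? ℓ u)
  hubλ R p u = δ (ℓ u ℕ.≤? p)
  hubρ B p u = δ (p ℕ.≤? ℓ u) - δ (p ℕ.≤? r u)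
  hubρ R p u = δ (suc (r u) ℕ.≤? p) - δ (ℓ u ℕ.≤? p)

  -- The number of arcs of a given colour through a given hub is a linear function of
  -- the inequality alone.
  hub : Colour → ℕ → Functional
  hub c p = eval (hubλ c p) (hubρ c p)

  hub-same : ∀ c p {x y} → Link c x y → ap (hub c p) (weightᶜ c x y) ≡ δ (p ℕ.≟ outhub c x)
  hub-same B p {x} {y} l = begin
    ap (hub B p) (weightᶜ B x y)
      ≡⟨ eval-B (hubλ B p) (hubρ B p) x y ⟩
    (- g (ℓ x)) - (- g (ℓ y)) + (g (ℓ x) - g (r x))
      ≡⟨ ring (g (ℓ x)) (g (ℓ y)) (g (r x)) ⟩
    g (ℓ y) - g (r x)
      ≡⟨ cong (λ q → g q - g (r x)) (sym l) ⟩
    g (suc (r x)) - g (r x)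
      ≡⟨ δ-≤-suc p (r x) ⟩
    δ (p ℕ.≟ suc (r x)) ∎
    where
    open ≡-Reasoning
    g : ℕ → ℤ
    g q = δ (p ℕ.≤? q)
    ring : ∀ a b c → (- a) - (- b) + (a - c) ≡ b - c
    ring = solve-∀
  hub-same R p {x} {y} l = begin
    ap (hub R p) (weightᶜ R x y)
      ≡⟨ eval-R (hubλ R p) (hubρ R p) x y ⟩
    h (ℓ x) - h (ℓ y) - (h (suc (r y)) - h (ℓ y))
      ≡⟨ ring (h (ℓ x)) (h (ℓ y)) (h (suc (r y))) ⟩
    h (ℓ x) - h (suc (r y))
      ≡⟨ cong (λ q → h (ℓ x) - h (suc q)) (sym l) ⟩
    h (ℓ x) - h (suc (ℓ x))
      ≡⟨ δ-suc-≤ p (ℓ x) ⟩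
    δ (p ℕ.≟ ℓ x) ∎
    where
    open ≡-Reasoning
    h : ℕ → ℤ
    h q = δ (q ℕ.≤? p)
    ring : ∀ a b c → a - b - (c - b) ≡ a - c
    ring = solve-∀

  hub-other : ∀ c p {c′ x y} → c′ ≢ c → Link c′ x y → ap (hub c p) (weightᶜ c′ x y) ≡ 0ℤ
  hub-other B p {B} c′≢c l = contradiction refl c′≢c
  hub-other B p {R} {x} {y} c′≢c l = begin
    ap (hub B p) (weightᶜ R x y)
      ≡⟨ eval-R (hubλ B p) (hubρ B p) x y ⟩
    (- g (ℓ x)) - (- g (ℓ y)) - (g (ℓ y) - g (r y))
      ≡⟨ cong (λ q → (- g q) - (- g (ℓ y)) - (g (ℓ y) - g (r y))) l ⟩
    (- g (r y)) - (- g (ℓ y)) - (g (ℓ y) - g (r y))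
      ≡⟨ ring (g (r y)) (g (ℓ y)) ⟩
    0ℤ ∎
    where
    open ≡-Reasoning
    g : ℕ → ℤ
    g q = δ (p ℕ.≤? q)
    ring : ∀ a b → (- a) - (- b) - (b - a) ≡ 0ℤ
    ring = solve-∀
  hub-other R p {B} {x} {y} c′≢c l = begin
    ap (hub R p) (weightᶜ B x y)
      ≡⟨ eval-B (hubλ R p) (hubρ R p) x y ⟩
    h (ℓ x) - h (ℓ y) + (h (suc (r x)) - h (ℓ x))
      ≡⟨ cong (λ q → h (ℓ x) - h (ℓ y) + (h q - h (ℓ x))) l ⟩
    h (ℓ x) - h (ℓ y) + (h (ℓ y) - h (ℓ x))
      ≡⟨ ring (h (ℓ x)) (h (ℓ y)) ⟩
    0ℤ ∎
    where
    open ≡-Reasoning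
    h : ℕ → ℤ
    h q = δ (q ℕ.≤? p)
    ring : ∀ a b → a - b + (b - a) ≡ 0ℤ
    ring = solve-∀
  hub-other R p {R} c′≢c l = contradiction refl c′≢c

  -- Functionals counting arcs at a vertex, and the faces they cut out

  -- On colour `c` these count departures from `u` or arrivals at `u`; the other colour enters at
  -- the opposite end with a minus sign. `outc c u` and `inc c u` differ by the coordinate `λᶜ u`,
  -- which vanishes on cycles, but they distribute the same total differently over the arcs and so
  -- yield different faces.
  outc inc : Colour → Fin n → Functional
  outc B u = coord (ρᶜ u)
  outc R u = coord (λᶜ u) ⊞ - 1ℤ ⊡ coord (ρᶜ u)
  inc  B u = coord (ρᶜ u) ⊞ - 1ℤ ⊡ coord (λᶜ u)
  inc  R u = - 1ℤ ⊡ coord (ρᶜ u)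

  outc-same : ∀ c u x y → ap (outc c u) (weightᶜ c x y) ≡ e x u
  outc-same B u x y = refl
  outc-same R u x y = ring (e x u) (e y u)
    where
    ring : ∀ a b → a - b + (- 1ℤ) * (- b) ≡ a
    ring = solve-∀

  outc-other : ∀ c u {c′} x y → c′ ≢ c → ap (outc c u) (weightᶜ c′ x y) ≡ - e y u
  outc-other B u {B} x y c′≢c = contradiction refl c′≢c
  outc-other B u {R} x y c′≢c = refl
  outc-other R u {B} x y c′≢c = ring (e x u) (e y u)
    where
    ring : ∀ a b → a - b + (- 1ℤ) * a ≡ - b
    ring = solve-∀
  outc-other R u {R} x y c′≢c = contradiction refl c′≢c

  inc-same : ∀ c u x y → ap (inc c u) (weightᶜ c x y) ≡ e y u
  inc-same B u x y = ring (e x u) (e y u)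
    where
    ring : ∀ a b → a + (- 1ℤ) * (a - b) ≡ b
    ring = solve-∀
  inc-same R u x y = ring (e y u)
    where
    ring : ∀ b → (- 1ℤ) * (- b) ≡ b
    ring = solve-∀

  inc-other : ∀ c u {c′} x y → c′ ≢ c → ap (inc c u) (weightᶜ c′ x y) ≡ - e x u
  inc-other B u {B} x y c′≢c = contradiction refl c′≢c
  inc-other B u {R} x y c′≢c = ring (e x u) (e y u)
    where
    ring : ∀ a b → (- b) + (- 1ℤ) * (a - b) ≡ - a
    ring = solve-∀
  inc-other R u {B} x y c′≢c = ring (e x u)
    where
    ring : ∀ a → (- 1ℤ) * a ≡ - a
    ring = solve-∀
  inc-other R u {R} x y c′≢c = contradiction refl c′≢c

  -- The arcs satisfying Z span a face of the cone of cycle inequalities.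
  record Face (Z : Colour → Fin n → Fin n → Set) : Set where
    field
      φ      : Functional
      nonneg : ∀ c x y → Link c x y → 0ℤ ≤ ap φ (weightᶜ c x y)
      sound  : ∀ c x y → Link c x y → ap φ (weightᶜ c x y) ≡ 0ℤ → Z c x y
      tight  : ∀ c x y → Link c x y → Z c x y → ap φ (weightᶜ c x y) ≡ 0ℤ

  AvoidsHub : Colour → ℕ → Colour → Fin n → Fin n → Set
  AvoidsHub c p c′ x y = c′ ≡ c → outhub c x ≢ p

  -- The conditions met by all arcs of a cycle without shared hubs that passes through `u` with both
  -- arcs of colour `c`.
  OutForced InForced : Colour → Fin n → Colour → Fin n → Fin n → Set
  OutForced c u c′ x y = (c′ ≡ c → outhub c x ≡ outhub c u → x ≡ u) × (c′ ≢ c → y ≢ u)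
  InForced  c u c′ x y = (c′ ≡ c → inhub c y ≡ inhub c u → y ≡ u) × (c′ ≢ c → x ≢ u)

  hub-face : ∀ c p → Face (AvoidsHub c p)
  hub-face c p = record { φ = hub c p ; nonneg = nonneg ; sound = sound ; tight = tight }
    where
    nonneg : ∀ c′ x y → Link c′ x y → 0ℤ ≤ ap (hub c p) (weightᶜ c′ x y)
    nonneg c′ x y l with c′ ≟ᶜ c
    ... | yes refl rewrite hub-same c p l = δ≥0 (p ℕ.≟ outhub c x)
    ... | no c′≢c  rewrite hub-other c p c′≢c l = ℤ.≤-refl
    sound : ∀ c′ x y → Link c′ x y → ap (hub c p) (weightᶜ c′ x y) ≡ 0ℤ → AvoidsHub c p c′ x y
    sound _ x y l eq refl x≡p = δ≡0⇒¬ (p ℕ.≟ outhub c x) (trans (sym (hub-same c p l)) eq) (sym x≡p)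
    tight : ∀ c′ x y → Link c′ x y → AvoidsHub c p c′ x y → ap (hub c p) (weightᶜ c′ x y) ≡ 0ℤ
    tight c′ x y l avoid with c′ ≟ᶜ c
    ... | yes refl = trans (hub-same c p l) (δ-false (p ℕ.≟ outhub c x) (avoid refl ∘ sym))
    ... | no c′≢c  = hub-other c p c′≢c l

  -- Departures from `u` are part of the traffic of its hub. The difference counts the arcs of
  -- colour `c` leaving that hub from another vertex and, through the minus sign in `outc-other`,
  -- the arcs of the other colour entering `u`.
  out-face : ∀ c u → Face (OutForced c u)
  out-face c u = record { φ = φ ; nonneg = nonneg ; sound = sound ; tight = tight }
    where
    φ : Functional
    φ = hub c (outhub c u) ⊞ - 1ℤ ⊡ outc c u
    same : ∀ {x y} → Link c x y →
           ap φ (weightᶜ c x y) ≡ δ (outhub c u ℕ.≟ outhub c x) - δ (x ≟ u)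
    same {x} {y} l = cong₂ _+_ (hub-same c _ l)
      (trans (ℤ.-1*i≡-i _) (cong -_ (trans (outc-same c u x y) (e≡δ x u))))
    other : ∀ {c′ x y} → c′ ≢ c → Link c′ x y → ap φ (weightᶜ c′ x y) ≡ δ (y ≟ u)
    other {c′} {x} {y} c′≢c l = trans (cong₂ _+_ (hub-other c _ c′≢c l)
      (trans (cong (- 1ℤ *_) (trans (outc-other c u x y c′≢c) (cong -_ (e≡δ y u)))) (ring _)))
      (ℤ.+-identityˡ _)
      where
      ring : ∀ a → (- 1ℤ) * (- a) ≡ a
      ring = solve-∀
    nonneg : ∀ c′ x y → Link c′ x y → 0ℤ ≤ ap φ (weightᶜ c′ x y)
    nonneg c′ x y l with c′ ≟ᶜ c
    ... | yes refl rewrite same l = δ-δ≥0 (outhub c u ℕ.≟ outhub c x) (x ≟ u) (sym ∘ cong (outhub c))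
    ... | no c′≢c  rewrite other c′≢c l = δ≥0 (y ≟ u)
    sound : ∀ c′ x y → Link c′ x y → ap φ (weightᶜ c′ x y) ≡ 0ℤ → OutForced c u c′ x y
    sound c′ x y l eq =
      (λ { refl x≡u → δ-δ≡0⇒ (outhub c u ℕ.≟ outhub c x) (x ≟ u)
                        (trans (sym (same l)) eq) (sym x≡u) }) ,
      (λ c′≢c → δ≡0⇒¬ (y ≟ u) (trans (sym (other c′≢c l)) eq))
    tight : ∀ c′ x y → Link c′ x y → OutForced c u c′ x y → ap φ (weightᶜ c′ x y) ≡ 0ℤ
    tight c′ x y l (f , g) with c′ ≟ᶜ c
    ... | yes refl = trans (same l) (⇒δ-δ≡0 (outhub c u ℕ.≟ outhub c x) (x ≟ u)
                                      (sym ∘ cong (outhub c)) (f refl ∘ sym))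
    ... | no c′≢c  = trans (other c′≢c l) (δ-false (y ≟ u) (g c′≢c))

  in-face : ∀ c u → Face (InForced c u)
  in-face c u = record { φ = φ ; nonneg = nonneg ; sound = sound ; tight = tight }
    where
    φ : Functional
    φ = hub c (inhub c u) ⊞ - 1ℤ ⊡ inc c u
    same : ∀ {x y} → Link c x y →
           ap φ (weightᶜ c x y) ≡ δ (inhub c u ℕ.≟ inhub c y) - δ (y ≟ u)
    same {x} {y} l = cong₂ _+_ (trans (hub-same c _ l) (cong (λ q → δ (inhub c u ℕ.≟ q)) l))
      (trans (ℤ.-1*i≡-i _) (cong -_ (trans (inc-same c u x y) (e≡δ y u))))
    other : ∀ {c′ x y} → c′ ≢ c → Link c′ x y → ap φ (weightᶜ c′ x y) ≡ δ (x ≟ u)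
    other {c′} {x} {y} c′≢c l = trans (cong₂ _+_ (hub-other c _ c′≢c l)
      (trans (cong (- 1ℤ *_) (trans (inc-other c u x y c′≢c) (cong -_ (e≡δ x u)))) (ring _)))
      (ℤ.+-identityˡ _)
      where
      ring : ∀ a → (- 1ℤ) * (- a) ≡ a
      ring = solve-∀
    nonneg : ∀ c′ x y → Link c′ x y → 0ℤ ≤ ap φ (weightᶜ c′ x y)
    nonneg c′ x y l with c′ ≟ᶜ c
    ... | yes refl rewrite same l = δ-δ≥0 (inhub c u ℕ.≟ inhub c y) (y ≟ u) (sym ∘ cong (inhub c))
    ... | no c′≢c  rewrite other c′≢c l = δ≥0 (x ≟ u)
    sound : ∀ c′ x y → Link c′ x y → ap φ (weightᶜ c′ x y) ≡ 0ℤ → InForced c u c′ x y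
    sound c′ x y l eq =
      (λ { refl y≡u → δ-δ≡0⇒ (inhub c u ℕ.≟ inhub c y) (y ≟ u)
                        (trans (sym (same l)) eq) (sym y≡u) }) ,
      (λ c′≢c → δ≡0⇒¬ (x ≟ u) (trans (sym (other c′≢c l)) eq))
    tight : ∀ c′ x y → Link c′ x y → InForced c u c′ x y → ap φ (weightᶜ c′ x y) ≡ 0ℤ
    tight c′ x y l (f , g) with c′ ≟ᶜ c
    ... | yes refl = trans (same l) (⇒δ-δ≡0 (inhub c u ℕ.≟ inhub c y) (y ≟ u)
                                      (sym ∘ cong (inhub c)) (f refl ∘ sym))
    ... | no c′≢c  = trans (other c′≢c l) (δ-false (x ≟ u) (g c′≢c))

  -- Arcs, cycles and trails

  ⊕-! : ∀ F G x → (F ⊕ G) ! x ≡ F ! x + G ! x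
  ⊕-! F G κ      = refl
  ⊕-! F G (λᶜ u) = refl
  ⊕-! F G (ρᶜ u) = refl

  0F-! : ∀ x → 0F ! x ≡ 0ℤ
  0F-! κ      = refl
  0F-! (λᶜ u) = refl
  0F-! (ρᶜ u) = refl

  sumArcs-! : ∀ {t} (f : Fin t → Form ℤ) x → sumArcs f ! x ≡ sum (λ i → f i ! x)
  sumArcs-! {zero}  f x = 0F-! x
  sumArcs-! {suc t} f x =
    trans (⊕-! (f zero) _ x) (cong (λ z → f zero ! x + z) (sumArcs-! (λ i → f (suc i)) x))

  sumℤ-! : ∀ {t} (f : Fin t → Form ℤ) x → sumℤ f ! x ≡ sum (λ i → f i ! x)
  sumℤ-! {zero}  f x = 0F-! x
  sumℤ-! {suc t} f x =
    trans (⊕-! (f zero) _ x) (cong (λ z → f zero ! x + z) (sumℤ-! (λ i → f (suc i)) x))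

  scaleℕ-! : ∀ a F x → scaleℕ a F ! x ≡ + a * (F ! x)
  scaleℕ-! a F κ      = refl
  scaleℕ-! a F (λᶜ u) = refl
  scaleℕ-! a F (ρᶜ u) = refl

  !⇒≈ : ∀ {F G : Form ℤ} → (∀ x → F ! x ≡ G ! x) → F ≈ G
  !⇒≈ eq = eq κ , (λ u → eq (λᶜ u)) , (λ u → eq (ρᶜ u))

  ≈⇒! : ∀ {F G : Form ℤ} → F ≈ G → ∀ x → F ! x ≡ G ! x
  ≈⇒! (eqκ , eqλ , eqρ) κ      = eqκ
  ≈⇒! (eqκ , eqλ , eqρ) (λᶜ u) = eqλ u
  ≈⇒! (eqκ , eqλ , eqρ) (ρᶜ u) = eqρ u

  -- A loop counts as red: its weight is that of a red arc from a vertex to itself once the `ℓ`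
  -- terms cancel.
  colourOf : ∀ {x y} → Arc x y → Colour
  colourOf (blue _) = B
  colourOf (red _)  = R
  colourOf (loop _) = R

  link : ∀ {x y} (a : Arc x y) → Link (colourOf a) x y
  link (blue (_ , eq)) = sym eq
  link (red (_ , eq))  = sym eq
  link (loop eq)       = sym eq

  weight-! : ∀ {x y} (a : Arc x y) k → weight a ! k ≡ weightᶜ (colourOf a) x y k
  weight-! (blue _) κ      = refl
  weight-! (blue _) (λᶜ u) = refl
  weight-! (blue _) (ρᶜ u) = refl
  weight-! (red _)  κ      = refl
  weight-! (red _)  (λᶜ u) = refl
  weight-! (red _)  (ρᶜ u) = refl
  weight-! (loop _) κ      = refl
  weight-! {x} (loop _) (λᶜ u) = sym (ℤ.+-inverseʳ (e x u))
  weight-! (loop _) (ρᶜ u) = refl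

  -- The endpoints alone decide the order relation: for a red link with `x ≢ y`, `P x y` would give
  -- `r x < ℓ y ≤ r y = ℓ x ≤ r x`, and `P y x` would give `r y < ℓ x = r y`.
  toArc : ∀ c {x y} → Link c x y → Arc x y
  toArc B {x} {y} l = blue (proj₂ (proj₂ rep x y) (ℕ.≤-reflexive l) , sym l)
  toArc R {x} {y} l with x ≟ y
  ... | yes refl = loop (sym l)
  ... | no x≢y   = red ((x≢y , ¬x≺y , ¬y≺x) , sym l)
    where
    ¬x≺y : ¬ P x y
    ¬x≺y x≺y = ℕ.<⇒≱ (proj₁ (proj₂ rep x y) x≺y)
      (ℕ.≤-trans (proj₁ rep y) (ℕ.≤-trans (ℕ.≤-reflexive (sym l)) (proj₁ rep x)))
    ¬y≺x : ¬ P y x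
    ¬y≺x y≺x = ℕ.<-irrefl (sym l) (proj₁ (proj₂ rep y x) y≺x)

  weight-toArc : ∀ c {x y} (l : Link c x y) k → weight (toArc c l) ! k ≡ weightᶜ c x y k
  weight-toArc c {x} {y} l k =
    trans (weight-! (toArc c l) k) (cong (λ c′ → weightᶜ c′ x y k) (colour c l))
    where
    colour : ∀ c {x y} (l : Link c x y) → colourOf (toArc c l) ≡ c
    colour B l = refl
    colour R {x} {y} l with x ≟ y
    ... | yes refl = refl
    ... | no  _    = refl

  module _ (C : Cycle) where

    open Cycle C using (k; v; simple; arc; close)

    arcAtᵛ : {i : Fin (suc k)} (w : View i) → Arc (v i) (v (nextᵛ w))
    arcAtᵛ ‵fromℕ             = close
    arcAtᵛ (‵inj₁ {i = i} _) = arc i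

    arcAt : (i : Fin (suc k)) → Arc (v i) (v (next i))
    arcAt i = arcAtᵛ (view i)

    col : Fin (suc k) → Colour
    col i = colourOf (arcAt i)

    linkAt : ∀ i → Link (col i) (v i) (v (next i))
    linkAt i = link (arcAt i)

    arcW : Fin (suc k) → Coord → ℤ
    arcW i = weightᶜ (col i) (v i) (v (next i))

    ineq : Coord → ℤ
    ineq x = cycleIneq C ! x

    ineq-sum : ∀ x → ineq x ≡ sum (λ i → arcW i x)
    ineq-sum x = begin
      (sumArcs (λ i → weight (arc i)) ⊕ weight close) ! x
        ≡⟨ ⊕-! (sumArcs (λ i → weight (arc i))) (weight close) x ⟩
      sumArcs (λ i → weight (arc i)) ! x + weight close ! x
        ≡⟨ cong (λ z → z + weight close ! x) (sumArcs-! (λ i → weight (arc i)) x) ⟩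
      sum (λ i → weight (arc i) ! x) + weight close ! x
        ≡⟨ sym (cong₂ _+_ (sum-cong-≗ {k} (λ i → cong (λ w → weight (arcAtᵛ w) ! x) (view-inject₁ i)))
                          (cong (λ w → weight (arcAtᵛ w) ! x) (view-fromℕ k))) ⟩
      sum (λ i → weight (arcAt (inject₁ i)) ! x) + weight (arcAt (fromℕ k)) ! x
        ≡⟨ sym (sum-init-last (λ i → weight (arcAt i) ! x)) ⟩
      sum (λ i → weight (arcAt i) ! x)
        ≡⟨ sum-cong-≗ {suc k} (λ i → weight-! (arcAt i) x) ⟩
      sum (λ i → arcW i x) ∎
      where open ≡-Reasoning

    ap-ineq : ∀ φ → ap φ ineq ≡ sum (λ i → ap φ (arcW i))
    ap-ineq φ = trans (ap-cong φ ineq-sum) (ap-sum φ arcW)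

  -- The colours of the first and last arc are indices because they determine the hubs at which the
  -- ends may be exchanged. Vertices may repeat.
  data Trail : Colour → Colour → Fin n → Fin n → Set where
    single : ∀ {c x y} → Link c x y → Trail c c x y
    cons   : ∀ {c c′ d x y z} → Link c x y → Trail c′ d y z → Trail c d x z

  trailW : ∀ {c d x z} → Trail c d x z → Coord → ℤ
  trailW (single {c} {x} {y} l) k = weightᶜ c x y k
  trailW (cons {c} {x = x} {y} l q) k = weightᶜ c x y k + trailW q k

  -- The weight of an arc separates into a share of its tail and a share of its head, the constant
  -- going to the tail, so replacing one end changes one share only.
  outW inW : Colour → Fin n → Coord → ℤ
  outW B x κ      = 1ℤ
  outW R x κ      = 0ℤ
  outW c x (λᶜ u) = e x u
  outW B x (ρᶜ u) = e x u
  outW R x (ρᶜ u) = 0ℤ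
  inW  c x κ      = 0ℤ
  inW  c x (λᶜ u) = - e x u
  inW  B x (ρᶜ u) = 0ℤ
  inW  R x (ρᶜ u) = - e x u

  weight-out+in : ∀ c x y k → weightᶜ c x y k ≡ outW c x k + inW c y k
  weight-out+in B x y κ      = refl
  weight-out+in R x y κ      = refl
  weight-out+in B x y (λᶜ u) = refl
  weight-out+in R x y (λᶜ u) = refl
  weight-out+in B x y (ρᶜ u) = sym (ℤ.+-identityʳ (e x u))
  weight-out+in R x y (ρᶜ u) = sym (ℤ.+-identityˡ (- e y u))

  module _ {c d : Colour} where

    restart : ∀ {x x′ y} → outhub c x′ ≡ outhub c x → Trail c d x y → Trail c d x′ y
    restart eq (single l) = single (trans eq l)
    restart eq (cons l q) = cons (trans eq l) q

    restart-W : ∀ {x x′ y} (eq : outhub c x′ ≡ outhub c x) (q : Trail c d x y) k →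
                trailW (restart eq q) k + outW c x k ≡ trailW q k + outW c x′ k
    restart-W {x} {x′} {y} eq (single l) k
      rewrite weight-out+in c x y k | weight-out+in c x′ y k = ring (outW c x′ k) (inW c y k) (outW c x k)
      where
      ring : ∀ a b a′ → a + b + a′ ≡ a′ + b + a
      ring = solve-∀
    restart-W {x} {x′} eq (cons {y = y} l q) k
      rewrite weight-out+in c x y k | weight-out+in c x′ y k =
        ring (outW c x′ k) (inW c y k) (trailW q k) (outW c x k)
      where
      ring : ∀ a b w a′ → a + b + w + a′ ≡ a′ + b + w + a
      ring = solve-∀

  reend : ∀ {c d x y y′} → inhub d y ≡ inhub d y′ → Trail c d x y → Trail c d x y′
  reend eq (single l) = single (trans l eq)
  reend eq (cons l q) = cons l (reend eq q)

  reend-W : ∀ {c d x y y′} (eq : inhub d y ≡ inhub d y′) (q : Trail c d x y) k →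
            trailW (reend eq q) k + inW d y k ≡ trailW q k + inW d y′ k
  reend-W {c} {y = y} {y′} eq (single {x = x} l) k
    rewrite weight-out+in c x y k | weight-out+in c x y′ k = ring (outW c x k) (inW c y k) (inW c y′ k)
    where
    ring : ∀ a b b′ → a + b′ + b ≡ a + b + b′
    ring = solve-∀
  reend-W {d = d} {y = y} {y′} eq (cons {c} {x = x} {y = u} l q) k =
    trans (ℤ.+-assoc (weightᶜ c x u k) _ _)
      (trans (cong (λ z → weightᶜ c x u k + z) (reend-W eq q k))
        (sym (ℤ.+-assoc (weightᶜ c x u k) _ _)))

  -- Loop erasure

  data Path : Fin n → Fin n → Set where
    []   : ∀ {x} → Path x x
    step : ∀ c {x y z} → Link c x y → Path y z → Path x z

  pathW : ∀ {x z} → Path x z → Coord → ℤ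
  pathW []                    k = 0ℤ
  pathW (step c {x} {y} l p) k = weightᶜ c x y k + pathW p k

  On : ∀ {x z} → Fin n → Path x z → Set
  On u ([] {x})           = u ≡ x
  On u (step c {x} l p) = u ≡ x ⊎ On u p

  on? : ∀ {x z} u (p : Path x z) → Dec (On u p)
  on? u ([] {x})           = u ≟ x
  on? u (step c {x} l p) = (u ≟ x) ⊎-dec on? u p

  on-end : ∀ {x z} (p : Path x z) → On z p
  on-end []           = refl
  on-end (step c l p) = inj₂ (on-end p)

  Simple : ∀ {x z} → Path x z → Set
  Simple []                 = ⊤
  Simple (step c {x} l p) = ¬ On x p × Simple p

  cut : ∀ {u x z} (p : Path x z) → Simple p → On u p →
        ∃₂ λ (p₁ : Path x u) (p₂ : Path u z) →
          Simple p₁ × Simple p₂ × (∀ k → pathW p k ≡ pathW p₁ k + pathW p₂ k) ×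
          (∀ w → On w p₁ → On w p)
  cut [] _ refl = [] , [] , tt , tt , (λ k → refl) , (λ w o → o)
  cut (step c l p) s (inj₁ refl) =
    [] , step c l p , tt , s , (λ k → sym (ℤ.+-identityˡ _)) , (λ w → inj₁)
  cut (step c {x} {y} l p) (x∉p , s) (inj₂ o) with cut p s o
  ... | p₁ , p₂ , s₁ , s₂ , eq , sub =
    step c l p₁ , p₂ , (x∉p ∘ sub x , s₁) , s₂ ,
    (λ k → trans (cong (λ z → weightᶜ c x y k + z) (eq k)) (sym (ℤ.+-assoc (weightᶜ c x y k) _ _))) ,
    λ { w (inj₁ w≡x) → inj₁ w≡x ; w (inj₂ ow) → inj₂ (sub w ow) }

  pathLength : ∀ {x z} → Path x z → ℕ
  pathLength []           = zero
  pathLength (step c l p) = suc (pathLength p)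

  vertex : ∀ {x z} (p : Path x z) → Fin (suc (pathLength p)) → Fin n
  vertex {x} p            zero    = x
  vertex     (step c l p) (suc i) = vertex p i

  vertex-last : ∀ {x z} (p : Path x z) → vertex p (fromℕ (pathLength p)) ≡ z
  vertex-last []           = refl
  vertex-last (step c l p) = vertex-last p

  vertex-on : ∀ {x z} (p : Path x z) i → On (vertex p i) p
  vertex-on []           zero    = refl
  vertex-on (step c l p) zero    = inj₁ refl
  vertex-on (step c l p) (suc i) = inj₂ (vertex-on p i)

  vertex-injective : ∀ {x z} (p : Path x z) → Simple p → ∀ {i j} → vertex p i ≡ vertex p j → i ≡ j
  vertex-injective p s {zero} {zero} eq = refl
  vertex-injective (step c l p) (x∉p , s) {zero} {suc j} eq =
    contradiction (subst (λ u → On u p) (sym eq) (vertex-on p j)) x∉p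
  vertex-injective (step c l p) (x∉p , s) {suc i} {zero} eq =
    contradiction (subst (λ u → On u p) eq (vertex-on p i)) x∉p
  vertex-injective (step c l p) (x∉p , s) {suc i} {suc j} eq = cong suc (vertex-injective p s eq)

  pathArc : ∀ {x z} (p : Path x z) i → Arc (vertex p (inject₁ i)) (vertex p (suc i))
  pathArc (step c l p) zero    = toArc c l
  pathArc (step c l p) (suc i) = pathArc p i

  pathArc-W : ∀ {x z} (p : Path x z) k → sum (λ i → weight (pathArc p i) ! k) ≡ pathW p k
  pathArc-W []           k = refl
  pathArc-W (step c l p) k = cong₂ _+_ (weight-toArc c l k) (pathArc-W p k)

  closeUp : ∀ c {x y} → Link c x y → (p : Path y x) → Simple p → Cycle
  closeUp c {y = y} l p s = record
    { k      = pathLength p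
    ; v      = vertex p
    ; simple = vertex-injective p s
    ; arc    = pathArc p
    ; close  = toArc c (subst (λ u → Link c u y) (sym (vertex-last p)) l)
    }

  closeUp-ineq : ∀ c {x y} (l : Link c x y) (p : Path y x) (s : Simple p) k →
                 ineq (closeUp c l p s) k ≡ weightᶜ c x y k + pathW p k
  closeUp-ineq c {x} {y} l p s k = begin
    (sumArcs (λ i → weight (pathArc p i)) ⊕ weight a) ! k
      ≡⟨ ⊕-! (sumArcs (λ i → weight (pathArc p i))) (weight a) k ⟩
    sumArcs (λ i → weight (pathArc p i)) ! k + weight a ! k
      ≡⟨ cong₂ _+_ (trans (sumArcs-! (λ i → weight (pathArc p i)) k) (pathArc-W p k)) (weight-toArc c _ k) ⟩
    pathW p k + weightᶜ c (vertex p (fromℕ (pathLength p))) y k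
      ≡⟨ cong (λ u → pathW p k + weightᶜ c u y k) (vertex-last p) ⟩
    pathW p k + weightᶜ c x y k
      ≡⟨ ℤ.+-comm (pathW p k) _ ⟩
    weightᶜ c x y k + pathW p k ∎
    where
    open ≡-Reasoning
    a : Arc (vertex p (fromℕ (pathLength p))) y
    a = toArc c (subst (λ u → Link c u y) (sym (vertex-last p)) l)

  total : List Cycle → Coord → ℤ
  total cs k = sum (λ i → ineq (lookup cs i) k)

  LoopErasure : Fin n → Fin n → (Coord → ℤ) → Set
  LoopErasure x z w =
    Σ (Path x z) λ p → Simple p × Σ (List Cycle) λ cs → ∀ k → w k ≡ pathW p k + total cs k

  -- If `x` already lies on the erased path, the part up to `x` and the new arc close up to a simple
  -- cycle, and the part from `x` on becomes the new path.
  push : ∀ c {x y z w} → Link c x y → LoopErasure y z w →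
         LoopErasure x z (λ k → weightᶜ c x y k + w k)
  push c {x} {y} {w = w} l (p , s , cs , eq) with on? x p
  ... | no x∉p = step c l p , (x∉p , s) , cs ,
    (λ k → trans (cong (λ z → weightᶜ c x y k + z) (eq k)) (sym (ℤ.+-assoc (weightᶜ c x y k) _ _)))
  ... | yes x∈p with cut p s x∈p
  ... | p₁ , p₂ , s₁ , s₂ , eq′ , _ = p₂ , s₂ , closeUp c l p₁ s₁ ∷ cs , λ k → begin
    weightᶜ c x y k + w k
      ≡⟨ cong (λ z → weightᶜ c x y k + z) (trans (eq k) (cong (λ z → z + total cs k) (eq′ k))) ⟩
    weightᶜ c x y k + (pathW p₁ k + pathW p₂ k + total cs k)
      ≡⟨ ring (weightᶜ c x y k) (pathW p₁ k) (pathW p₂ k) (total cs k) ⟩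
    pathW p₂ k + (weightᶜ c x y k + pathW p₁ k + total cs k)
      ≡⟨ cong (λ z → pathW p₂ k + (z + total cs k)) (sym (closeUp-ineq c l p₁ s₁ k)) ⟩
    pathW p₂ k + total (closeUp c l p₁ s₁ ∷ cs) k ∎
    where
    open ≡-Reasoning
    ring : ∀ a b c d → a + (b + c + d) ≡ c + (a + b + d)
    ring = solve-∀

  erase : ∀ {c d x z} (q : Trail c d x z) → LoopErasure x z (trailW q)
  erase (single {c} {x} {y} l) with push c l ([] , tt , [] , λ k → refl)
  ... | p , s , cs , eq = p , s , cs , λ k → trans (sym (ℤ.+-identityʳ (weightᶜ c x y k))) (eq k)
  erase (cons {c} l q) = push c l (erase q)

  -- A simple path from a vertex to itself is empty, so loop erasure of a closed trail leaves only
  -- cycles.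
  decompose : ∀ {c d x} (q : Trail c d x x) → Σ (List Cycle) λ cs → ∀ k → trailW q k ≡ total cs k
  decompose q with erase q
  ... | [] , _ , cs , eq = cs , λ k → trans (eq k) (ℤ.+-identityˡ _)
  ... | step c l p , (x∉p , _) , _ = contradiction (on-end p) x∉p

  -- Splitting a cycle in two

  -- A blue arc contributes 1 to the constant and 1 to the sum of the `ρ` coefficients, a red arc 0
  -- and -1; hence the factor 2 gives both the value 1.
  lengthF : Functional
  lengthF = (1ℤ + 1ℤ) ⊡ coord κ ⊞ - 1ℤ ⊡ pair ρᶜ (λ _ → 1ℤ)

  lengthF-arc : ∀ c x y → ap lengthF (weightᶜ c x y) ≡ 1ℤ
  lengthF-arc B x y = cong (λ z → (1ℤ + 1ℤ) * 1ℤ + - 1ℤ * z) (pair-e (λ _ → 1ℤ) x)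
  lengthF-arc R x y = cong (λ z → (1ℤ + 1ℤ) * 0ℤ + - 1ℤ * z) (pair--e (λ _ → 1ℤ) y)

  lengthF-trail : ∀ {c d x z} (q : Trail c d x z) → 1ℤ ≤ ap lengthF (trailW q)
  lengthF-trail (single {c} {x} {y} l) = ℤ.≤-reflexive (sym (lengthF-arc c x y))
  lengthF-trail (cons {c} {x = x} {y} l q) = begin
    1ℤ                                                      ≤⟨ +≤+ (ℕ.s≤s z≤n) ⟩
    1ℤ + 1ℤ                                                 ≤⟨ ℤ.+-mono-≤ (ℤ.≤-reflexive (sym (lengthF-arc c x y))) (lengthF-trail q) ⟩
    ap lengthF (weightᶜ c x y) + ap lengthF (trailW q)      ≡⟨ sym (ap-+ lengthF (weightᶜ c x y) (trailW q)) ⟩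
    ap lengthF (λ k → weightᶜ c x y k + trailW q k)         ∎
    where open ℤ.≤-Reasoning

  lengthF-cycle : ∀ C → 1ℤ ≤ ap lengthF (ineq C)
  lengthF-cycle C = begin
    1ℤ                                          ≡⟨ sym (ℤ.+-identityʳ 1ℤ) ⟩
    1ℤ + 0ℤ                                     ≤⟨ ℤ.+-mono-≤ (≤1 zero) (sum-nonneg (λ i → a (suc i)) (λ i → ℤ.≤-trans (+≤+ z≤n) (≤1 (suc i)))) ⟩
    sum a                                       ≡⟨ sym (ap-ineq C lengthF) ⟩
    ap lengthF (ineq C)                         ∎
    where
    open ℤ.≤-Reasoning
    a : Fin (suc (Cycle.k C)) → ℤ
    a i = ap lengthF (arcW C i)
    ≤1 : ∀ i → 1ℤ ≤ a i
    ≤1 i = ℤ.≤-reflexive (sym (lengthF-arc (col C i) (Cycle.v C i) (Cycle.v C (next i))))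

  total-++ : ∀ cs ds k → total (cs ++ ds) k ≡ total cs k + total ds k
  total-++ []       ds k = sym (ℤ.+-identityˡ _)
  total-++ (C ∷ cs) ds k =
    trans (cong (λ z → ineq C k + z) (total-++ cs ds k)) (sym (ℤ.+-assoc (ineq C k) _ _))

  total-nonneg : ∀ cs → 0ℤ ≤ ap lengthF (total cs)
  total-nonneg [] = ℤ.≤-reflexive (sym (ap-0 lengthF))
  total-nonneg (C ∷ cs) = subst (0ℤ ≤_) (sym (ap-+ lengthF (ineq C) (total cs)))
    (ℤ.+-mono-≤ (ℤ.≤-trans (+≤+ z≤n) (lengthF-cycle C)) (total-nonneg cs))

  total-bounds : ∀ cs → All (λ D → ap lengthF (ineq D) ≤ ap lengthF (total cs)) cs
  total-bounds [] = []
  total-bounds (C ∷ cs) = C≤ ∷ All.map (λ {D} D≤ → ℤ.≤-trans {ap lengthF (ineq D)} D≤ cs≤) (total-bounds cs)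
    where
    eq : ap lengthF (total (C ∷ cs)) ≡ ap lengthF (ineq C) + ap lengthF (total cs)
    eq = ap-+ lengthF (ineq C) (total cs)
    C≤ : ap lengthF (ineq C) ≤ ap lengthF (total (C ∷ cs))
    C≤ = subst₂ _≤_ (ℤ.+-identityʳ _) (sym eq) (ℤ.+-monoʳ-≤ (ap lengthF (ineq C)) (total-nonneg cs))
    cs≤ : ap lengthF (total cs) ≤ ap lengthF (total (C ∷ cs))
    cs≤ = subst₂ _≤_ (ℤ.+-identityˡ _) (sym eq)
      (ℤ.+-monoˡ-≤ (ap lengthF (total cs)) (ℤ.≤-trans (+≤+ z≤n) (lengthF-cycle C)))

  -- lengthF counts arcs, so a cycle occurring in either closed trail is strictly
  -- shorter than C and hence not equivalent to it.
  splitting : ∀ C {c d x} {c′ d′ y} (q : Trail c d x x) (q′ : Trail c′ d′ y y) →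
              (∀ k → trailW q k + trailW q′ k ≡ ineq C k) → IntegrallyRedundant C
  splitting C q q′ eq with decompose q | decompose q′
  ... | cs , eqs | ds , eqs′ =
    length (cs ++ ds) , lookup (cs ++ ds) , (λ _ → 1) , inequivalent , !⇒≈ λ k → begin
      ineq C k
        ≡⟨ sym (eq k) ⟩
      trailW q k + trailW q′ k
        ≡⟨ cong₂ _+_ (eqs k) (eqs′ k) ⟩
      total cs k + total ds k
        ≡⟨ sym (total-++ cs ds k) ⟩
      sum (λ i → ineq (lookup (cs ++ ds) i) k)
        ≡⟨ sum-cong-≗ {length (cs ++ ds)} (λ i → sym (trans (scaleℕ-! 1 (cycleIneq (lookup (cs ++ ds) i)) k) (ℤ.*-identityˡ _))) ⟩
      sum (λ i → scaleℕ 1 (cycleIneq (lookup (cs ++ ds) i)) ! k)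
        ≡⟨ sym (sumℤ-! (λ i → scaleℕ 1 (cycleIneq (lookup (cs ++ ds) i))) k) ⟩
      sumℤ (λ i → scaleℕ 1 (cycleIneq (lookup (cs ++ ds) i))) ! k ∎
    where
    open ≡-Reasoning
    lengthC : ap lengthF (trailW q) + ap lengthF (trailW q′) ≡ ap lengthF (ineq C)
    lengthC = trans (sym (ap-+ lengthF (trailW q) (trailW q′))) (ap-cong lengthF eq)
    left : ∀ D → ap lengthF (ineq D) ≤ ap lengthF (total cs) → ap lengthF (ineq D) < ap lengthF (ineq C)
    left D D≤ = ℤ.≤-<-trans (subst (ap lengthF (ineq D) ≤_) (sym (ap-cong lengthF eqs)) D≤)
      (subst₂ _<_ (ℤ.+-identityʳ _) lengthC
        (ℤ.+-monoʳ-< (ap lengthF (trailW q)) (ℤ.<-≤-trans (+<+ (ℕ.s≤s z≤n)) (lengthF-trail q′))))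
    right : ∀ D → ap lengthF (ineq D) ≤ ap lengthF (total ds) → ap lengthF (ineq D) < ap lengthF (ineq C)
    right D D≤ = ℤ.≤-<-trans (subst (ap lengthF (ineq D) ≤_) (sym (ap-cong lengthF eqs′)) D≤)
      (subst₂ _<_ (ℤ.+-identityˡ _) lengthC
        (ℤ.+-monoˡ-< (ap lengthF (trailW q′)) (ℤ.<-≤-trans (+<+ (ℕ.s≤s z≤n)) (lengthF-trail q))))
    shorter : All (λ D → ap lengthF (ineq D) < ap lengthF (ineq C)) (cs ++ ds)
    shorter = ++⁺ (All.map (λ {D} → left D) (total-bounds cs)) (All.map (λ {D} → right D) (total-bounds ds))
    inequivalent : ∀ i → ¬ Equivalent (lookup (cs ++ ds) i) C
    inequivalent i D≈C = ℤ.<-irrefl (ap-cong lengthF (≈⇒! D≈C)) (All.lookup shorter (∈-lookup i))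

  module _ (C : Cycle) where

    open Cycle C using (k; v; simple)

    -- The end `b` is a separate argument so that it can be given as a position beyond `suc k`, for
    -- a segment that wraps around.
    segment : ∀ t a b → b ≡ t ℕ.+ a →
      Σ (Trail (col C (unroll a)) (col C (unroll b)) (v (unroll a)) (v (unroll (suc b)))) λ q →
        ∀ x → trailW q x ≡ window (λ m → arcW C (unroll m) x) a (suc t)
    segment zero    a _ refl = single (linkAt C (unroll a)) , λ x → sym (ℤ.+-identityʳ _)
    segment (suc t) a b eq with segment t (suc a) b (trans eq (sym (ℕ.+-suc t a)))
    ... | q , eqW = cons (linkAt C (unroll a)) q , λ x → cong (λ z → arcW C (unroll a) x + z) (eqW x)

    Split : Fin (suc k) → Fin (suc k) → Set
    Split i j =
      Σ (Trail (col C (next i)) (col C j) (v (next i)) (v (next j))) λ q →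
      Σ (Trail (col C (next j)) (col C i) (v (next j)) (v (next i))) λ q′ →
        ∀ x → trailW q x + trailW q′ x ≡ ineq C x

    split-< : ∀ {a b} → a ℕ.< b → b ℕ.< suc k → Split (unroll a) (unroll b)
    split-< {a} {b} a<b b<L with ℕ.m≤n⇒∃[o]m+o≡n a<b
    -- The two pieces have `suc t` and `suc t′` arcs, which together make up all `suc k`.
    ... | t , refl with ℕ.m≤n⇒∃[o]m+o≡n (ℕ.≤-trans (ℕ.s≤s (ℕ.s≤s (ℕ.m≤n+m t a))) b<L)
    ... | t′ , eqL = q , q′ , eqW
      where
      L : ℕ
      L = suc k
      Piece : ℕ → ℕ → Fin (suc k) → Set
      Piece t c j = Σ (Trail (col C (unroll c)) (col C j) (v (unroll c)) (v (next j))) λ q →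
                      ∀ x → trailW q x ≡ window (λ m → arcW C (unroll m) x) c (suc t)
      piece : Piece t (suc a) (unroll b)
      piece = segment t (suc a) b (ℕ.+-comm (suc a) t)
      wrap : ∀ a t t′ → t′ ℕ.+ suc (suc a ℕ.+ t) ≡ a ℕ.+ (suc (suc t) ℕ.+ t′)
      wrap = ℕsolve-∀
      -- This piece runs past the end of the cycle to position `a + L`, one full period after `a`.
      piece′ : Piece t′ (suc b) (unroll a)
      piece′ = subst (Piece t′ (suc b)) (unroll-+-period a)
        (segment t′ (suc b) (a ℕ.+ L) (trans (cong (a ℕ.+_) (sym eqL)) (sym (wrap a t t′))))
      q = proj₁ piece
      q′ = proj₁ piece′
      f : Coord → ℕ → ℤ
      f x m = arcW C (unroll m) x
      eqW : ∀ x → trailW q x + trailW q′ x ≡ ineq C x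
      eqW x = begin
        trailW q x + trailW q′ x
          ≡⟨ cong₂ _+_ (proj₂ piece x) (proj₂ piece′ x) ⟩
        window (f x) (suc a) (suc t) + window (f x) (suc b) (suc t′)
          ≡⟨ cong (λ m → window (f x) (suc a) (suc t) + window (f x) (suc m) (suc t′)) (ℕ.+-comm (suc a) t) ⟩
        window (f x) (suc a) (suc t) + window (f x) (suc t ℕ.+ suc a) (suc t′)
          ≡⟨ sym (window-+ (f x) (suc a) (suc t) (suc t′)) ⟩
        window (f x) (suc a) (suc t ℕ.+ suc t′)
          ≡⟨ cong (window (f x) (suc a)) (trans (ℕ.+-suc (suc t) t′) eqL) ⟩
        window (f x) (suc a) L
          ≡⟨ window-periodic (f x) L (λ m → cong (λ i → arcW C i x) (unroll-+-period m)) (suc a) ⟩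
        window (f x) 0 L
          ≡⟨ window-sum (f x) 0 L ⟩
        sum {L} (λ i → f x (toℕ i))
          ≡⟨ sum-cong-≗ {L} (λ i → cong (λ j → arcW C j x) (unroll-toℕ i)) ⟩
        sum {L} (λ i → arcW C i x)
          ≡⟨ sym (ineq-sum C x) ⟩
        ineq C x ∎
        where open ≡-Reasoning

    split : ∀ {i j} → i ≢ j → Split i j
    split {i} {j} i≢j with ℕ.<-cmp (toℕ i) (toℕ j)
    ... | tri< i<j _ _ = subst₂ Split (unroll-toℕ i) (unroll-toℕ j) (split-< i<j (Fin.toℕ<n j))
    ... | tri≈ _ i≡j _ = contradiction (Fin.toℕ-injective i≡j) i≢j
    ... | tri> _ _ j<i with subst₂ Split (unroll-toℕ j) (unroll-toℕ i) (split-< j<i (Fin.toℕ<n i))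
    ... | q , q′ , eq = q′ , q , λ x → trans (ℤ.+-comm (trailW q′ x) (trailW q x)) (eq x)

    SharedHub : Set
    SharedHub = ∃₂ λ i j → i ≢ j × col C i ≡ col C j × outhub (col C i) (v i) ≡ outhub (col C i) (v j)

    -- `q` ends with arc `j` and `q′` with arc `i`. Each last arc is redirected to the head of the
    -- other, which closes both trails; as the colours agree, the shares of the two heads are merely
    -- swapped.
    shared-hub : SharedHub → IntegrallyRedundant C
    shared-hub (i , j , i≢j , eqc , eqh) with split i≢j
    ... | q , q′ , eqW =
      splitting C (reend (sym hubs) q) (reend hubs′ q′) balance
      where
      hubs : inhub (col C j) (v (next i)) ≡ inhub (col C j) (v (next j))
      hubs = trans (cong (λ c → inhub c (v (next i))) (sym eqc))
        (trans (sym (linkAt C i)) (trans eqh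
          (trans (cong (λ c → outhub c (v j)) eqc) (linkAt C j))))
      hubs′ : inhub (col C i) (v (next i)) ≡ inhub (col C i) (v (next j))
      hubs′ = subst (λ c → inhub c (v (next i)) ≡ inhub c (v (next j))) (sym eqc) hubs
      balance : ∀ x → trailW (reend (sym hubs) q) x + trailW (reend hubs′ q′) x ≡ ineq C x
      balance x = +-cancelʳ (p′ + p) _ _ (begin
        a′ + b′ + (p′ + p)     ≡⟨ ring a′ b′ p′ p ⟩
        (a′ + p′) + (b′ + p)   ≡⟨ cong₂ _+_ (reend-W (sym hubs) q x) eq₂ ⟩
        (a + p) + (b + p′)     ≡⟨ ring′ a p b p′ ⟩
        a + b + (p′ + p)       ≡⟨ cong (λ z → z + (p′ + p)) (eqW x) ⟩
        ineq C x + (p′ + p)    ∎)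
        where
        open ≡-Reasoning
        a a′ b b′ p p′ : ℤ
        a  = trailW q x
        a′ = trailW (reend (sym hubs) q) x
        b  = trailW q′ x
        b′ = trailW (reend hubs′ q′) x
        p  = inW (col C j) (v (next i)) x
        p′ = inW (col C j) (v (next j)) x
        eq₂ : b′ + p ≡ b + p′
        eq₂ = subst (λ c → b′ + inW c (v (next i)) x ≡ b + inW c (v (next j)) x) eqc
                (reend-W hubs′ q′ x)
        ring : ∀ a b p q → a + b + (p + q) ≡ (a + p) + (b + q)
        ring = solve-∀
        ring′ : ∀ a p b q → (a + p) + (b + q) ≡ a + b + (q + p)
        ring′ = solve-∀

    -- C turns at the left and at the right endpoint of z: reaching z from one of the
    -- turns and leaving it at the other, in both directions, closes two shorter trails.
    ShortCut : Set
    ShortCut = ∃ λ z → ∃₂ λ i j →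
      col C (next i) ≢ col C i × col C j ≡ col C (next i) × col C (next j) ≡ col C i ×
      inhub (col C i) z ≡ inhub (col C i) (v (next i)) ×
      outhub (col C i) z ≡ outhub (col C i) (v (next j))

    -- Entering in one colour and leaving in the other uses a single endpoint: the left one from
    -- blue to red, the right one from red to blue.
    turn-out : ∀ {c d x y} → d ≢ c → inhub c x ≡ inhub c y → outhub d x ≡ outhub d y
    turn-out {B} {B} d≢c eq = contradiction refl d≢c
    turn-out {B} {R} d≢c eq = eq
    turn-out {R} {B} d≢c eq = cong suc eq
    turn-out {R} {R} d≢c eq = contradiction refl d≢c

    turn-in : ∀ {c d x y} → d ≢ c → outhub c x ≡ outhub c y → inhub d x ≡ inhub d y
    turn-in {B} {B} d≢c eq = contradiction refl d≢c
    turn-in {B} {R} d≢c eq = ℕ.suc-injective eq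
    turn-in {R} {B} d≢c eq = eq
    turn-in {R} {R} d≢c eq = contradiction refl d≢c

    -- The contribution of a turn does not depend on the vertex at which it is made.
    turn-W : ∀ {c d} x y → d ≢ c → ∀ k → outW d x k + inW c x k ≡ outW d y k + inW c y k
    turn-W {B} {B} x y d≢c k      = contradiction refl d≢c
    turn-W {R} {R} x y d≢c k      = contradiction refl d≢c
    turn-W {B} {R} x y d≢c κ      = refl
    turn-W {R} {B} x y d≢c κ      = refl
    turn-W {B} {R} x y d≢c (λᶜ u) = trans (ℤ.+-inverseʳ (e x u)) (sym (ℤ.+-inverseʳ (e y u)))
    turn-W {R} {B} x y d≢c (λᶜ u) = trans (ℤ.+-inverseʳ (e x u)) (sym (ℤ.+-inverseʳ (e y u)))
    turn-W {B} {R} x y d≢c (ρᶜ u) = refl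
    turn-W {R} {B} x y d≢c (ρᶜ u) = trans (ℤ.+-inverseʳ (e x u)) (sym (ℤ.+-inverseʳ (e y u)))

    -- `C` turns from `c` to `d` at `x` and back at `y`. The vertex `z` shares the endpoint used at
    -- `x` and the one used at `y`, so it can replace both ends of `q` and both ends of `q′`.
    through : ∀ {c d} z x y → d ≢ c → inhub c z ≡ inhub c x → outhub c z ≡ outhub c y →
              (q : Trail d d x y) (q′ : Trail c c y x) →
              (∀ k → trailW q k + trailW q′ k ≡ ineq C k) → IntegrallyRedundant C
    through {c} {d} z x y d≢c eqx eqy q q′ eqW =
      splitting C (reend endd (restart startd q)) (reend (sym eqx) (restart eqy q′)) balance
      where
      startd : outhub d z ≡ outhub d x
      startd = turn-out d≢c eqx
      endd : inhub d y ≡ inhub d z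
      endd = turn-in d≢c (sym eqy)
      -- The new closed trails pass `z` without a turn, once in each colour. Regrouped crosswise,
      -- their four shares at `z` form two turns, which `turn-W` exchanges for the turns at `x` and
      -- `y`.
      balance : ∀ k → trailW (reend endd (restart startd q)) k +
                      trailW (reend (sym eqx) (restart eqy q′)) k ≡ ineq C k
      balance k = +-cancelʳ (a₁ + b₁ + ((odx + icx) + (ocy + idy))) _ _ (begin
        a₂ + b₂ + (a₁ + b₁ + ((odx + icx) + (ocy + idy)))
          ≡⟨ ring a₂ b₂ a₁ b₁ odx icx ocy idy ⟩
        (a₁ + odx) + (a₂ + idy) + ((b₁ + ocy) + (b₂ + icx))
          ≡⟨ cong₂ _+_ (cong₂ _+_ (restart-W startd q k) (reend-W endd (restart startd q) k))
                       (cong₂ _+_ (restart-W eqy q′ k) (reend-W (sym eqx) (restart eqy q′) k)) ⟩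
        (a₀ + odz) + (a₁ + idz) + ((b₀ + ocz) + (b₁ + icz))
          ≡⟨ ring′ a₀ odz a₁ idz b₀ ocz b₁ icz ⟩
        a₀ + b₀ + (a₁ + b₁ + ((odz + icz) + (ocz + idz)))
          ≡⟨ cong₂ _+_ (eqW k) (cong (λ w → a₁ + b₁ + w)
               (sym (cong₂ _+_ (turn-W x z d≢c k) (turn-W y z (d≢c ∘ sym) k)))) ⟩
        ineq C k + (a₁ + b₁ + ((odx + icx) + (ocy + idy))) ∎)
        where
        open ≡-Reasoning
        a₀ a₁ a₂ b₀ b₁ b₂ odx odz idy idz ocy ocz icx icz : ℤ
        a₀ = trailW q k
        a₁ = trailW (restart startd q) k
        a₂ = trailW (reend endd (restart startd q)) k
        b₀ = trailW q′ k
        b₁ = trailW (restart eqy q′) k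
        b₂ = trailW (reend (sym eqx) (restart eqy q′)) k
        odx = outW d x k
        odz = outW d z k
        idy = inW d y k
        idz = inW d z k
        ocy = outW c y k
        ocz = outW c z k
        icx = inW c x k
        icz = inW c z k
        ring : ∀ a₂ b₂ a₁ b₁ odx icx ocy idy →
          a₂ + b₂ + (a₁ + b₁ + ((odx + icx) + (ocy + idy))) ≡
          (a₁ + odx) + (a₂ + idy) + ((b₁ + ocy) + (b₂ + icx))
        ring = solve-∀
        ring′ : ∀ a₀ odz a₁ idz b₀ ocz b₁ icz →
          (a₀ + odz) + (a₁ + idz) + ((b₀ + ocz) + (b₁ + icz)) ≡
          a₀ + b₀ + (a₁ + b₁ + ((odz + icz) + (ocz + idz)))
        ring′ = solve-∀

    short-cut : ShortCut → IntegrallyRedundant C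
    short-cut (z , i , j , d≢c , eqj , eqnj , eqin , eqout) =
      through z (v (next i)) (v (next j)) d≢c eqin eqout
        (proj₁ retyped) (proj₁ (proj₂ retyped)) (proj₂ (proj₂ retyped))
      where
      i≢j : i ≢ j
      i≢j refl = d≢c (sym eqj)
      Pieces : Colour → Colour → Set
      Pieces cj cnj =
        Σ (Trail (col C (next i)) cj (v (next i)) (v (next j))) λ q →
        Σ (Trail cnj (col C i) (v (next j)) (v (next i))) λ q′ →
          ∀ x → trailW q x + trailW q′ x ≡ ineq C x
      retyped : Pieces (col C (next i)) (col C i)
      retyped = subst₂ Pieces eqj eqnj (split i≢j)

  -- Cycles on the same face

  passage : Colour → Colour → Fin n → Coord → ℤ
  passage c d u x = outW d u x + inW c u x

  -- Shifting the tail shares by one index groups the sum by vertices. Only passages without a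
  -- change of colour leave a `ρ` term, positive for blue and negative for red.
  ineq-passages : ∀ C x →
    ineq C x ≡ sum (λ i → passage (col C i) (col C (next i)) (Cycle.v C (next i)) x)
  ineq-passages C x = begin
    ineq C x
      ≡⟨ ineq-sum C x ⟩
    sum (λ i → arcW C i x)
      ≡⟨ sum-cong-≗ {suc k} (λ i → weight-out+in (col C i) (v i) (v (next i)) x) ⟩
    sum (λ i → o i + inW (col C i) (v (next i)) x)
      ≡⟨ ∑-distrib-+ o (λ i → inW (col C i) (v (next i)) x) ⟩
    sum o + sum (λ i → inW (col C i) (v (next i)) x)
      ≡⟨ cong (λ z → z + sum (λ i → inW (col C i) (v (next i)) x)) (sym (sum-next o)) ⟩
    sum (λ i → o (next i)) + sum (λ i → inW (col C i) (v (next i)) x)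
      ≡⟨ sym (∑-distrib-+ (λ i → o (next i)) (λ i → inW (col C i) (v (next i)) x)) ⟩
    sum (λ i → passage (col C i) (col C (next i)) (v (next i)) x) ∎
    where
    open ≡-Reasoning
    open Cycle C using (k; v)
    o : Fin (suc k) → ℤ
    o i = outW (col C i) (v i) x

  lco-zero : ∀ C w → ineq C (λᶜ w) ≡ 0ℤ
  lco-zero C w = trans (ineq-passages C (λᶜ w)) (sum-zero _ λ i →
    cancel (col C i) (col C (next i)) (Cycle.v C (next i)))
    where
    cancel : ∀ c d u → passage c d u (λᶜ w) ≡ 0ℤ
    cancel B B u = ℤ.+-inverseʳ (e u w)
    cancel B R u = ℤ.+-inverseʳ (e u w)
    cancel R B u = ℤ.+-inverseʳ (e u w)
    cancel R R u = ℤ.+-inverseʳ (e u w)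

  e-≢ : ∀ {u w} → u ≢ w → e u w ≡ 0ℤ
  e-≢ {u} {w} u≢w = trans (e≡δ u w) (δ-false (u ≟ w) u≢w)

  passage-zero : ∀ c d u w → (u ≡ w → c ≢ d) → passage c d u (ρᶜ w) ≡ 0ℤ
  passage-zero B B u w h = trans (ℤ.+-identityʳ (e u w)) (e-≢ (λ u≡w → h u≡w refl))
  passage-zero B R u w h = refl
  passage-zero R B u w h = ℤ.+-inverseʳ (e u w)
  passage-zero R R u w h = trans (ℤ.+-identityˡ (- e u w)) (cong -_ (e-≢ (λ u≡w → h u≡w refl)))

  no-passage : ∀ C {w} → (∀ i → Cycle.v C (next i) ≡ w → col C i ≢ col C (next i)) →
               ineq C (ρᶜ w) ≡ 0ℤ
  no-passage C {w} none = trans (ineq-passages C (ρᶜ w)) (sum-zero _ λ i →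
    passage-zero (col C i) (col C (next i)) (Cycle.v C (next i)) w (none i))

  passage-at : ∀ C {w} i → Cycle.v C (next i) ≡ w →
    ineq C (ρᶜ w) ≡ passage (col C i) (col C (next i)) (Cycle.v C (next i)) (ρᶜ w)
  passage-at C {w} i eqv = trans (ineq-passages C (ρᶜ w)) (sum-single
    (λ i → passage (col C i) (col C (next i)) (Cycle.v C (next i)) (ρᶜ w)) i λ j j≢i →
      passage-zero (col C j) (col C (next j)) (Cycle.v C (next j)) w λ eqv′ →
        contradiction (next-injective (Cycle.simple C (trans eqv′ (sym eqv)))) j≢i)

  lengths : Functional
  lengths = eval (λ u → + ℓ u) (λ u → + r u - + ℓ u)

  -- The given representation attains equality in every cycle inequality.
  equality : ∀ C → ineq C κ + ap lengths (ineq C) ≡ 0ℤ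
  equality C = trans (ap-ineq C (coord κ ⊞ lengths))
    (sum-zero _ λ i → arc-tight (col C i) (Cycle.v C i) (Cycle.v C (next i)) (linkAt C i))
    where
    arc-tight : ∀ c x y → Link c x y → weightᶜ c x y κ + ap lengths (weightᶜ c x y) ≡ 0ℤ
    arc-tight B x y l = begin
      1ℤ + ap lengths (weightᶜ B x y)               ≡⟨ cong (λ z → 1ℤ + z) (eval-B (λ u → + ℓ u) (λ u → + r u - + ℓ u) x y) ⟩
      1ℤ + (+ ℓ x - + ℓ y + (+ r x - + ℓ x))        ≡⟨ cong (λ q → 1ℤ + (+ ℓ x - + q + (+ r x - + ℓ x))) (sym l) ⟩
      1ℤ + (+ ℓ x - (1ℤ + + r x) + (+ r x - + ℓ x)) ≡⟨ ring (+ ℓ x) (+ r x) ⟩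
      0ℤ                                            ∎
      where
      open ≡-Reasoning
      ring : ∀ a b → 1ℤ + (a - (1ℤ + b) + (b - a)) ≡ 0ℤ
      ring = solve-∀
    arc-tight R x y l = begin
      0ℤ + ap lengths (weightᶜ R x y)               ≡⟨ cong (λ z → 0ℤ + z) (eval-R (λ u → + ℓ u) (λ u → + r u - + ℓ u) x y) ⟩
      0ℤ + (+ ℓ x - + ℓ y - (+ r y - + ℓ y))        ≡⟨ cong (λ q → 0ℤ + (+ q - + ℓ y - (+ r y - + ℓ y))) l ⟩
      0ℤ + (+ r y - + ℓ y - (+ r y - + ℓ y))        ≡⟨ ring (+ ℓ y) (+ r y) ⟩
      0ℤ                                            ∎
      where
      open ≡-Reasoning
      ring : ∀ a b → 0ℤ + (b - a - (b - a)) ≡ 0ℤ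
      ring = solve-∀

  -- By `equality` and `lco-zero` the `ρ` coefficients determine the number of blue arcs.
  const-eq : ∀ D C → (∀ w → ineq D (ρᶜ w) ≡ ineq C (ρᶜ w)) → ineq D κ ≡ ineq C κ
  const-eq D C eqρ = +-cancelʳ (ap lengths (ineq C)) _ _ (begin
    ineq D κ + ap lengths (ineq C) ≡⟨ cong (λ z → ineq D κ + z) (sym same) ⟩
    ineq D κ + ap lengths (ineq D) ≡⟨ equality D ⟩
    0ℤ                             ≡⟨ sym (equality C) ⟩
    ineq C κ + ap lengths (ineq C) ∎)
    where
    open ≡-Reasoning
    same : ap lengths (ineq D) ≡ ap lengths (ineq C)
    same = cong₂ _+_
      (sum-cong-≗ {n} (λ u → cong (λ z → + ℓ u * z) (trans (lco-zero D u) (sym (lco-zero C u)))))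
      (sum-cong-≗ {n} (λ u → cong (λ z → (+ r u - + ℓ u) * z) (eqρ u)))

  sameHub : ∀ C → ¬ SharedHub C → ∀ {c i j} → col C i ≡ c → col C j ≡ c →
            outhub c (Cycle.v C i) ≡ outhub c (Cycle.v C j) → i ≡ j
  sameHub C ¬shared {i = i} {j} refl eqj eqh with i ≟ j
  ... | yes i≡j = i≡j
  ... | no  i≢j = contradiction (i , j , i≢j , sym eqj , eqh) ¬shared

  other-colour : ∀ {c d d′ : Colour} → d ≢ c → d′ ≢ c → d ≡ d′
  other-colour {B} {R} {R} _ _ = refl
  other-colour {R} {B} {B} _ _ = refl
  other-colour {B} {B} d≢c _ = contradiction refl d≢c
  other-colour {R} {R} d≢c _ = contradiction refl d≢c
  other-colour {B} {R} {B} _ d′≢c = contradiction refl d′≢c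
  other-colour {R} {B} {R} _ d′≢c = contradiction refl d′≢c

  OnFace : (Colour → Fin n → Fin n → Set) → Cycle → Set
  OnFace Z C = ∀ i → Z (col C i) (Cycle.v C i) (Cycle.v C (next i))

  -- D lies on every face of the cone of cycle inequalities that contains C, and C is
  -- irreducible; then D passes from hub to hub exactly as C does.
  module Following (C D : Cycle) (¬shared : ¬ SharedHub C) (¬short : ¬ ShortCut C)
    (transfer : ∀ {Z} → Face Z → OnFace Z C → OnFace Z D) where

    open Cycle C using () renaming (v to vC; simple to simpleC)
    open Cycle D using () renaming (v to vD; simple to simpleD)

    -- The tails may differ, as they can where the cycles turn; the hub is all that fixes the
    -- continuation.
    Match : Fin (suc (Cycle.k C)) → Fin (suc (Cycle.k D)) → Set
    Match i j = col C i ≡ col D j × outhub (col C i) (vC i) ≡ outhub (col C i) (vD j)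

    -- Otherwise `C` would lie on the face avoiding the hub of arc `j`, hence so would `D`, but arc
    -- `j` itself goes through it.
    match-from-D : ∀ j → ∃ λ i → Match i j
    match-from-D j with any? (λ i → (col C i ≟ᶜ col D j) ×-dec (outhub (col C i) (vC i) ℕ.≟ outhub (col C i) (vD j)))
    ... | yes found = found
    ... | no ¬found = contradiction refl (transfer (hub-face c (outhub c (vD j))) avoids j refl)
      where
      c : Colour
      c = col D j
      avoids : OnFace (AvoidsHub c (outhub c (vD j))) C
      avoids i eqc eqh = ¬found (i , eqc ,
        subst (λ d → outhub d (vC i) ≡ outhub d (vD j)) (sym eqc) eqh)

    match-head : ∀ {i j} → Match i j → inhub (col C i) (vC (next i)) ≡ inhub (col C i) (vD (next j))
    match-head {i} {j} (eqc , eqh) = trans (sym (linkAt C i)) (trans eqh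
      (subst (λ c → Link c (vD j) (vD (next j))) (sym eqc) (linkAt D j)))

    -- Without shared hubs, arc `next m` is the only one of its colour through its hub; by
    -- simplicity arc `m` is the only one entering its tail, and it has that same colour.
    out-forced : ∀ m → col C (next m) ≡ col C m → OnFace (OutForced (col C m) (vC (next m))) C
    out-forced m eqm i =
      (λ eqi eqh → cong vC (sameHub C ¬shared eqi eqm eqh)) ,
      (λ i≢c eqv → i≢c (cong (col C) (next-injective (simpleC eqv))))

    in-forced : ∀ m → col C (next m) ≡ col C m → OnFace (InForced (col C m) (vC (next m))) C
    in-forced m eqm i =
      (λ eqi eqh → cong (λ i → vC (next i)) (sameHub C ¬shared eqi refl
        (trans (subst (λ c → Link c (vC i) (vC (next i))) eqi (linkAt C i))
          (trans eqh (sym (linkAt C m)))))) ,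
      (λ i≢c eqv → i≢c (trans (cong (col C) (simpleC eqv)) eqm))

    -- If `D` went straight on at `z` where `C` turns, the arc of `C` matching the next arc of `D`
    -- would have to be reached somehow; either colour of its predecessor `m` is impossible.
    no-crossing : ∀ {i j} → Match i j → col C (next i) ≢ col C i → col D (next j) ≢ col C i
    no-crossing {i} {j} match turn eqd with match-from-D (next j)
    ... | m₀ , eqm₀ , eqh₀ with next-surjective m₀
    ... | m , refl = go
      where
      c : Colour
      c = col C i
      z : Fin n
      z = vD (next j)
      eqm : col C (next m) ≡ c
      eqm = trans eqm₀ eqd
      eqh : outhub c (vC (next m)) ≡ outhub c z
      eqh = subst (λ d → outhub d (vC (next m)) ≡ outhub d z) eqm eqh₀
      go : ⊥
      go with col C m ≟ᶜ c
      -- `C` turns away from `c` after `i` and back to `c` after `m`, at the two endpoints of `z`: a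
      -- short cut.
      ... | no m≢c = ¬short (z , i , m , turn , other-colour m≢c turn , eqm ,
                             sym (match-head match) , sym eqh)
      -- `C` passes straight after `m`, so the out-face forces `z` to be the vertex passed; then
      -- arcs `m` and `i` enter through one hub and coincide, contrary to the turn after `i`.
      ... | yes m≡c = turn (trans (cong (λ k → col C (next k)) (sym m≡i)) eqm)
        where
        z≡ : z ≡ vC (next m)
        z≡ = proj₁ (transfer (out-face (col C m) (vC (next m))) (out-forced m (trans eqm (sym m≡c))) (next j))
               (trans eqd (sym m≡c)) (subst (λ d → outhub d z ≡ outhub d (vC (next m))) (sym m≡c) (sym eqh))
        m≡i : m ≡ i
        m≡i = sameHub C ¬shared m≡c refl (trans
          (subst (λ d → Link d (vC m) (vC (next m))) m≡c (linkAt C m))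
          (trans (cong (inhub c) (sym z≡)) (trans (sym (match-head match)) (sym (linkAt C i)))))

    -- With two colours, a turn of `C` leaves `D` no choice once crossing is excluded. Where `C`
    -- goes straight, the in-face fixes the head of arc `j` and forbids leaving it in the other
    -- colour.
    follow : ∀ {i j} → Match i j →
             col C (next i) ≡ col D (next j) × (col C (next i) ≡ col C i → vC (next i) ≡ vD (next j))
    follow {i} {j} match@(eqc , _) with col C (next i) ≟ᶜ col C i
    ... | no turn = other-colour turn (no-crossing match turn) , λ eqi → contradiction eqi turn
    ... | yes straight = trans straight (sym D-straight) , λ _ → sym z≡y
      where
      forced : OnFace (InForced (col C i) (vC (next i))) D
      forced = transfer (in-face (col C i) (vC (next i))) (in-forced i straight)
      z≡y : vD (next j) ≡ vC (next i)
      z≡y = proj₁ (forced j) (sym eqc) (sym (match-head match))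
      D-straight : col D (next j) ≡ col C i
      D-straight with col D (next j) ≟ᶜ col C i
      ... | yes eq = eq
      ... | no neq = contradiction z≡y (proj₂ (forced (next j)) neq)

    match-next : ∀ {i j} → Match i j → Match (next i) (next j)
    match-next {i} {j} match = proj₁ (follow match) , hubs
      where
      hubs : outhub (col C (next i)) (vC (next i)) ≡ outhub (col C (next i)) (vD (next j))
      hubs with col C (next i) ≟ᶜ col C i
      ... | yes straight = cong (outhub (col C (next i))) (proj₂ (follow match) straight)
      ... | no turn = turn-out C turn (match-head match)

    match-from-C : ∀ i → ∃ λ j → Match i j
    match-from-C = next-induction (proj₁ (match-from-D zero)) (zero , proj₂ (match-from-D zero))
      λ { i (j , match) → next j , match-next match }

    rco-eq : ∀ w → ineq D (ρᶜ w) ≡ ineq C (ρᶜ w)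
    rco-eq w with any? (λ i → (vC (next i) ≟ w) ×-dec (col C i ≟ᶜ col C (next i)))
    ... | yes (i , eqv , eqc) with match-from-C i
    ...   | j , match = begin
      ineq D (ρᶜ w)
        ≡⟨ passage-at D j (trans (sym (proj₂ (follow match) (sym eqc))) eqv) ⟩
      passage (col D j) (col D (next j)) (vD (next j)) (ρᶜ w)
        ≡⟨ cong₂ (λ c d → passage c d (vD (next j)) (ρᶜ w)) (sym (proj₁ match)) (sym (proj₁ (follow match))) ⟩
      passage (col C i) (col C (next i)) (vD (next j)) (ρᶜ w)
        ≡⟨ cong (λ u → passage (col C i) (col C (next i)) u (ρᶜ w)) (sym (proj₂ (follow match) (sym eqc))) ⟩
      passage (col C i) (col C (next i)) (vC (next i)) (ρᶜ w)
        ≡⟨ sym (passage-at C i eqv) ⟩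
      ineq C (ρᶜ w) ∎
      where open ≡-Reasoning
    rco-eq w | no ¬straight = trans (no-passage D D-none) (sym (no-passage C C-none))
      where
      C-none : ∀ i → vC (next i) ≡ w → col C i ≢ col C (next i)
      C-none i eqv eqc = ¬straight (i , eqv , eqc)
      D-none : ∀ j → vD (next j) ≡ w → col D j ≢ col D (next j)
      -- A straight passage of `D` through `w` would be one of `C` through the same vertex.
      D-none j eqv eqc with match-from-D j
      ... | i , match = C-none i (trans (proj₂ (follow match) (sym straight)) eqv) straight
        where
        straight : col C i ≡ col C (next i)
        straight = trans (proj₁ match) (trans eqc (sym (proj₁ (follow match))))

    D≈C : Equivalent D C
    D≈C = !⇒≈ λ where
        κ      → const-eq D C rco-eq
        (λᶜ w) → trans (lco-zero D w) (sym (lco-zero C w))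
        (ρᶜ w) → rco-eq w

  -- From a rational combination to the conclusion

  sharedHub? : ∀ C → Dec (SharedHub C)
  sharedHub? C = any? λ i → any? λ j →
    ¬? (i ≟ j) ×-dec (col C i ≟ᶜ col C j) ×-dec
    (outhub (col C i) (v i) ℕ.≟ outhub (col C i) (v j))
    where open Cycle C using (v)

  shortCut? : ∀ C → Dec (ShortCut C)
  shortCut? C = any? λ z → any? λ i → any? λ j →
    ¬? (col C (next i) ≟ᶜ col C i) ×-dec (col C j ≟ᶜ col C (next i)) ×-dec
    (col C (next j) ≟ᶜ col C i) ×-dec
    (inhub (col C i) z ℕ.≟ inhub (col C i) (v (next i))) ×-dec
    (outhub (col C i) z ℕ.≟ outhub (col C i) (v (next j)))
    where open Cycle C using (v)

  combination : ∀ {t} → (Fin t → ℚ) → (Fin t → Form ℤ) → Form ℚ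
  combination α F = sumℚ (λ i → scaleℚ (α i) (formℚ (F i)))

  sumℚ-const : ∀ {t} (α : Fin t → ℚ) (F : Fin t → Form ℤ) →
    const (combination α F) ≡ ℚsum.sum (λ i → α i ℚ.* (F i ! κ) /1)
  sumℚ-const {zero}  α F = refl
  sumℚ-const {suc t} α F = cong (λ z → α zero ℚ.* toℚ (const (F zero)) ℚ.+ z)
    (sumℚ-const (λ i → α (suc i)) (λ i → F (suc i)))

  sumℚ-lco : ∀ {t} (α : Fin t → ℚ) (F : Fin t → Form ℤ) u →
    lco (combination α F) u ≡ ℚsum.sum (λ i → α i ℚ.* (F i ! λᶜ u) /1)
  sumℚ-lco {zero}  α F u = refl
  sumℚ-lco {suc t} α F u = cong (λ z → α zero ℚ.* toℚ (lco (F zero) u) ℚ.+ z)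
    (sumℚ-lco (λ i → α (suc i)) (λ i → F (suc i)) u)

  sumℚ-rco : ∀ {t} (α : Fin t → ℚ) (F : Fin t → Form ℤ) u →
    rco (combination α F) u ≡ ℚsum.sum (λ i → α i ℚ.* (F i ! ρᶜ u) /1)
  sumℚ-rco {zero}  α F u = refl
  sumℚ-rco {suc t} α F u = cong (λ z → α zero ℚ.* toℚ (rco (F zero) u) ℚ.+ z)
    (sumℚ-rco (λ i → α (suc i)) (λ i → F (suc i)) u)

  ≈-coordinates : ∀ {t} G (α : Fin t → ℚ) (F : Fin t → Form ℤ) → formℚ G ≈ combination α F →
    ∀ x → (G ! x) /1 ≡ ℚsum.sum (λ i → α i ℚ.* (F i ! x) /1)
  ≈-coordinates G α F (eqκ , eqλ , eqρ) κ      = trans eqκ (sumℚ-const α F)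
  ≈-coordinates G α F (eqκ , eqλ , eqρ) (λᶜ u) = trans (eqλ u) (sumℚ-lco α F u)
  ≈-coordinates G α F (eqκ , eqλ , eqρ) (ρᶜ u) = trans (eqρ u) (sumℚ-rco α F u)

  module _ (C : Cycle) {t} (D : Fin t → Cycle) (N : ℕ) (m : Fin t → ℕ) (N≢0 : N ≢ 0)
    (eq : ∀ x → + N * ineq C x ≡ sum (λ i → + m i * ineq (D i) x)) where

    ap-eq : ∀ φ → + N * ap φ (ineq C) ≡ sum (λ i → + m i * ap φ (ineq (D i)))
    ap-eq φ = begin
      + N * ap φ (ineq C)                              ≡⟨ sym (ap-* φ (+ N) (ineq C)) ⟩
      ap φ (λ x → + N * ineq C x)                      ≡⟨ ap-cong φ eq ⟩
      ap φ (λ x → sum (λ i → + m i * ineq (D i) x))    ≡⟨ ap-sum φ (λ i x → + m i * ineq (D i) x) ⟩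
      sum (λ i → ap φ (λ x → + m i * ineq (D i) x))    ≡⟨ sum-cong-≗ {t} (λ i → ap-* φ (+ m i) (ineq (D i))) ⟩
      sum (λ i → + m i * ap φ (ineq (D i)))            ∎
      where open ≡-Reasoning

    -- If all `m i` were zero, `lengthF` would vanish on the right, while `N` times the number of
    -- arcs of `C` is positive.
    positive-part : ∃ λ i → m i ≢ 0
    positive-part with any? (λ i → ¬? (m i ℕ.≟ 0))
    ... | yes found = found
    ... | no ¬found with ℤ.i*j≡0⇒i≡0∨j≡0 (+ N) (trans (ap-eq lengthF) (sum-zero _ vanishes))
      where
      vanishes : ∀ i → + m i * ap lengthF (ineq (D i)) ≡ 0ℤ
      vanishes i with m i in eqm
      ... | zero  = refl
      ... | suc _ = contradiction (i , λ m≡0 → ℕ.1+n≢0 (trans (sym eqm) m≡0)) ¬found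
    ...   | inj₁ N≡0 = contradiction (ℤ.+-injective N≡0) N≢0
    ...   | inj₂ len≡0 = contradiction (subst (1ℤ ≤_) len≡0 (lengthF-cycle C)) λ { (+≤+ ()) }

    -- Complementary slackness, used twice: a vanishing sum of nonnegative terms isolates the cycle
    -- `D i`, and then each of its arcs.
    transfer : ∀ {i} → m i ≢ 0 → ∀ {Z} → Face Z → OnFace Z C → OnFace Z (D i)
    transfer {i} mᵢ≢0 {Z} face on j =
      sound (col (D i) j) (v (D i) j) (v (D i) (next j)) (linkAt (D i) j)
        (sum≡0⇒all≡0 _ (arcs≥0 (D i)) (trans (sym (ap-ineq (D i) φ)) Dᵢ≡0) j)
      where
      open Face face
      open Cycle using (k; v)
      arcs≥0 : ∀ E (j : Fin (suc (k E))) → 0ℤ ≤ ap φ (arcW E j)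
      arcs≥0 E j = nonneg (col E j) (v E j) (v E (next j)) (linkAt E j)
      C≡0 : ap φ (ineq C) ≡ 0ℤ
      C≡0 = trans (ap-ineq C φ) (sum-zero _ λ j →
        Face.tight face (col C j) (v C j) (v C (next j)) (linkAt C j) (on j))
      terms≥0 : ∀ i → 0ℤ ≤ + m i * ap φ (ineq (D i))
      terms≥0 i = subst (_≤ + m i * ap φ (ineq (D i))) (ℤ.*-zeroʳ (+ m i))
        (ℤ.*-monoˡ-≤-nonNeg (+ m i) (subst (0ℤ ≤_) (sym (ap-ineq (D i) φ)) (sum-nonneg _ (arcs≥0 (D i)))))
      Dᵢ≡0 : ap φ (ineq (D i)) ≡ 0ℤ
      Dᵢ≡0 with ℤ.i*j≡0⇒i≡0∨j≡0 (+ m i)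
        (sum≡0⇒all≡0 _ terms≥0 (trans (sym (ap-eq φ)) (trans (cong (+ N *_) C≡0) (ℤ.*-zeroʳ (+ N)))) i)
      ... | inj₁ m≡0 = contradiction (ℤ.+-injective m≡0) mᵢ≢0
      ... | inj₂ eq₀ = eq₀

  redundant⇒integrallyRedundant : ∀ C → Redundant C → IntegrallyRedundant C
  redundant⇒integrallyRedundant C (t , D , α , α≥0 , D≉C , eq)
    with sharedHub? C | shortCut? C | clear-denominators α α≥0
  ... | yes shared | _         | _ = shared-hub C shared
  ... | no _       | yes short | _ = short-cut C short
  ... | no ¬shared | no ¬short | N , m , N≢0 , clear = contradiction D≈C (D≉C i)
    where
    integral : ∀ x → + N * ineq C x ≡ sum (λ i → + m i * ineq (D i) x)
    integral x = /1-injective (begin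
      (+ N * ineq C x) /1
        ≡⟨ /1-* (+ N) (ineq C x) ⟩
      + N /1 ℚ.* (ineq C x) /1
        ≡⟨ cong (λ z → + N /1 ℚ.* z) (≈-coordinates (cycleIneq C) α (λ i → cycleIneq (D i)) eq x) ⟩
      + N /1 ℚ.* ℚsum.sum (λ i → α i ℚ.* (ineq (D i) x) /1)
        ≡⟨ clear (λ i → ineq (D i) x) ⟩
      sum (λ i → + m i * ineq (D i) x) /1 ∎)
      where open ≡-Reasoning
    part : ∃ λ i → m i ≢ 0
    part = positive-part C D N m N≢0 integral
    i : Fin t
    i = proj₁ part
    D≈C : Equivalent (D i) C
    D≈C = Following.D≈C C (D i) ¬shared ¬short (transfer C D N m N≢0 integral (proj₂ part))

theorem5p1 : (n : ℕ) (P : Rel n) (ℓ r : Fin n → ℕ) → IsCanonical P ℓ r →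
    (C : KeyGraph.Cycle P ℓ r) → KeyGraph.Redundant P ℓ r C →
    KeyGraph.IntegrallyRedundant P ℓ r C
theorem5p1 n P ℓ r (rep , _) = Cycles.redundant⇒integrallyRedundant P ℓ r rep
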